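{- Let $G$ be the $m\times n$ grid with $m,n\ge 2$ and a cost function $c:V\to\mathbb{Q}_{\ge 0}$. (i) For every zigzag sequence $q_1,\dots,q_{2k}$ and every sequence $t_1,\dots,t_{2k}$ corresponding to it, the set $\{t_1,\dots,t_{2k}\}$ is a landmark set of $G$. (ii) Let $L$ be a landmark set of $G$ with $|L|\ge 4$ that is both minimal (with respect to inclusion) and of minimum cost. Then, after possibly renumbering the rows and columns of the grid by one of its eight symmetries (with the costs carried along), the vertices of $L$ can be ordered as $t_1,\dots,t_{2k}$ forming a perfect sequence for some zigzag sequence.
   Context: The $m\times n$ grid $G$ has vertex set $V=\{(i,j):1\le i\le m,\ 1\le j\le n\}$, with $(i_1,j_1),(i_2,j_2)$ adjacent iff $|i_1-i_2|+|j_1-j_2|=1$; thus $d((i_1,j_1),(i_2,j_2))=|i_1-i_2|+|j_1-j_2|$. The first coordinate is the row (row $1$ on top, row $m$ at the bottom) and the second is the column. A vertex $x$ separates $u,v$ if $d(x,u)\neq d(x,v)$. A landmark set is $L\subseteq V$ such that every pair of distinct vertices is separated by some vertex of $L$; it is minimal if no proper subset is a landmark set, and of minimum cost if $c(L)=\sum_{a\in L}c(a)$ is smallest among all landmark sets. The eight symmetries of the grid correspond to choosing which corner is numbered $(1,1)$ and which of its two neighbours is numbered $(1,2)$ (this may exchange the roles of $m$ and $n$). A zigzag sequence is a sequence $q_1,\dots,q_{2k}$ of vertices, $k\ge 2$, $q_i=(s_i,d_i)$, with $s_1=1$, $s_{2k}=m$; for even $i$: $d_i=d_{i-1}$ and $s_i>s_{i-1}$;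 for odd $i\ge 3$: $s_i=s_{i-1}$ and $d_i>d_{i-1}$. A sequence $t_1,\dots,t_{2k}$, $t_i=(b_i,c_i)$, corresponds to this zigzag sequence if $t_1=q_1$; for even $i$: $b_i=s_i$ and $c_i\le d_i$; for odd $i\ge 3$: $c_i=d_i$ and $b_i\le s_i$; and moreover $c_{2k}>c_1$. A corresponding sequence is perfect if its total cost $\sum_i c(t_i)$ is minimum among all sequences corresponding to the same zigzag sequence. -}

module Defs where

open import Data.Bool using (Bool; true; false; T)
open import Data.Fin using (Fin; zero; suc; toℕ; inject₁; opposite)
open import Data.Fin.Properties using (toℕ-inject₁)
open import Data.List using (List; map; foldr; length; filterᵇ; allFin; cartesianProduct; tabulate)
open import Data.Nat using (ℕ; zero; suc; _+_; _*_; _≤_; _<_; ∣_-_∣)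
open import Data.Nat.Divisibility using (_∣_)
open import Data.Nat.Properties as ℕₚ using (∣n-n∣≡0; ∣-∣-triangle; +-mono-≤; +-monoʳ-≤; +-suc; suc-injective)
open import Data.Nat.Solver using (module +-*-Solver)
open import Data.Product using (_×_; _,_; ∃-syntax)
open import Data.Rational as ℚ using (ℚ; 0ℚ)
open import Data.Sum using (_⊎_; inj₁; inj₂)
open import Level using (0ℓ)
open import Relation.Binary.PropositionalEquality using (_≡_; _≢_; refl; sym; trans; cong; cong₂; subst)
open import Relation.Nullary using (¬_)
open import Relation.Unary using (Pred; _∈_; _⊂_)

private
  variable
    m n m′ n′ k : ℕ

Vertex : ℕ → ℕ → Set
Vertex m n = Fin m × Fin n

-- Rows and columns are numbered from 1.
row col : Vertex m n → ℕ
row (i , j) = suc (toℕ i)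
col (i , j) = suc (toℕ j)

dist : Vertex m n → Vertex m n → ℕ
dist u v = ∣ row u - row v ∣ + ∣ col u - col v ∣

Adjacent : Vertex m n → Vertex m n → Set
Adjacent u v = ∣ row u - row v ∣ + ∣ col u - col v ∣ ≡ 1

data Walk {m n : ℕ} : Vertex m n → Vertex m n → ℕ → Set where
  stop : ∀ {u} → Walk u u 0
  step : ∀ {u w v l} → Adjacent u w → Walk w v l → Walk u v (suc l)

-- dist-attained and dist-minimal: dist is the shortest-path distance of the
-- graph with edge relation Adjacent.
private
  closer : ∀ {n} (i j : Fin n) →
    i ≡ j ⊎ (∃[ i′ ] ∣ toℕ i - toℕ {n} i′ ∣ ≡ 1 × ∣ toℕ i - toℕ j ∣ ≡ suc ∣ toℕ i′ - toℕ j ∣)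
  closer zero zero = inj₁ refl
  closer {suc (suc n)} zero (suc j) = inj₂ (suc zero , refl , refl)
  closer (suc i) zero = inj₂ (inject₁ i , eq₁ , eq₂)
    where
    suc-self : ∀ a → ∣ suc a - a ∣ ≡ 1
    suc-self zero    = refl
    suc-self (suc a) = suc-self a
    eq₁ : ∣ suc (toℕ i) - toℕ (inject₁ i) ∣ ≡ 1
    eq₁ rewrite toℕ-inject₁ i = suc-self (toℕ i)
    eq₂ : 1 + toℕ i ≡ 1 + ∣ toℕ (inject₁ i) - 0 ∣
    eq₂ rewrite toℕ-inject₁ i = cong suc (sym (ℕₚ.∣-∣-identityʳ (toℕ i)))
  closer (suc i) (suc j) with closer i j
  ... | inj₁ eq             = inj₁ (cong suc eq)
  ... | inj₂ (i′ , p , q) = inj₂ (suc i′ , p , q)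

  walk : ∀ l (u v : Vertex m n) → dist u v ≡ l → Walk u v l
  walk l (i , j) (i₂ , j₂) eq with closer i i₂
  walk zero (i , j) (i₂ , j₂) eq | inj₂ (i′ , p , q) with () ← trans (sym eq) (cong (_+ ∣ toℕ j - toℕ j₂ ∣) q)
  walk (suc l) (i , j) (i₂ , j₂) eq | inj₂ (i′ , p , q) =
    step (cong₂ _+_ p (∣n-n∣≡0 (toℕ j)))
         (walk l (i′ , j) (i₂ , j₂) (suc-injective (trans (cong (_+ ∣ toℕ j - toℕ j₂ ∣) (sym q)) eq)))
  walk l (i , j) (i , j₂) eq | inj₁ refl with closer j j₂
  walk zero (i , j) (i , j) eq | inj₁ refl | inj₁ refl = stop
  walk (suc l) (i , j) (i , j) eq | inj₁ refl | inj₁ refl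
    with () ← trans (sym eq) (cong₂ _+_ (∣n-n∣≡0 (toℕ i)) (∣n-n∣≡0 (toℕ j)))
  walk zero (i , j) (i , j₂) eq | inj₁ refl | inj₂ (j′ , p , q)
    with () ← trans (sym eq) (trans (cong (∣ toℕ i - toℕ i ∣ +_) q) (+-suc _ _))
  walk (suc l) (i , j) (i , j₂) eq | inj₁ refl | inj₂ (j′ , p , q) =
    step (cong₂ _+_ (∣n-n∣≡0 (toℕ i)) p)
         (walk l (i , j′) (i , j₂)
           (suc-injective (trans (sym (+-suc _ _)) (trans (cong (∣ toℕ i - toℕ i ∣ +_) (sym q)) eq))))

  dist-triangle : (u w v : Vertex m n) → dist u v ≤ dist u w + dist w v
  dist-triangle u w v = subst (dist u v ≤_) (shuffle ∣ row u - row w ∣ ∣ row w - row v ∣ ∣ col u - col w ∣ ∣ col w - col v ∣)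
    (+-mono-≤ (∣-∣-triangle (row u) (row w) (row v)) (∣-∣-triangle (col u) (col w) (col v)))
    where
    open +-*-Solver
    shuffle : ∀ a b c d → (a + b) + (c + d) ≡ (a + c) + (b + d)
    shuffle = solve 4 (λ a b c d → (a :+ b) :+ (c :+ d) := (a :+ c) :+ (b :+ d)) refl

dist-attained : (u v : Vertex m n) → Walk u v (dist u v)
dist-attained u v = walk (dist u v) u v refl

dist-minimal : ∀ {u v : Vertex m n} {l} → Walk u v l → dist u v ≤ l
dist-minimal {u = u} stop = ℕₚ.≤-reflexive (cong₂ _+_ (∣n-n∣≡0 (row u)) (∣n-n∣≡0 (col u)))
dist-minimal {u = u} {v} {suc l} (step {w = w} a ws) =
  ℕₚ.≤-trans (dist-triangle u w v)
    (subst (λ x → x + dist w v ≤ suc l) (sym a) (+-monoʳ-≤ 1 (dist-minimal ws)))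

Separates : Vertex m n → Vertex m n → Vertex m n → Set
Separates x u v = dist x u ≢ dist x v

IsLandmark : Pred (Vertex m n) 0ℓ → Set
IsLandmark {m} {n} S = (u v : Vertex m n) → u ≢ v → ∃[ x ] x ∈ S × Separates x u v

-- Sets of vertices, given by their characteristic functions.
VertexSet : ℕ → ℕ → Set
VertexSet m n = Vertex m n → Bool

⟦_⟧ : VertexSet m n → Pred (Vertex m n) 0ℓ
⟦ L ⟧ v = T (L v)

elements : VertexSet m n → List (Vertex m n)
elements {m} {n} L = filterᵇ L (cartesianProduct (allFin m) (allFin n))

card : VertexSet m n → ℕ
card L = length (elements L)

Cost : ℕ → ℕ → Set
Cost m n = Vertex m n → ℚ

total : Cost m n → List (Vertex m n) → ℚ
total c vs = foldr ℚ._+_ 0ℚ (map c vs)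

cost : Cost m n → VertexSet m n → ℚ
cost c L = total c (elements L)

IsMinimalLandmark : VertexSet m n → Set
IsMinimalLandmark {m} {n} L =
  IsLandmark ⟦ L ⟧ × ((L′ : VertexSet m n) → ⟦ L′ ⟧ ⊂ ⟦ L ⟧ → ¬ IsLandmark ⟦ L′ ⟧)

IsMinimumCostLandmark : Cost m n → VertexSet m n → Set
IsMinimumCostLandmark {m} {n} c L =
  IsLandmark ⟦ L ⟧ × ((L′ : VertexSet m n) → IsLandmark ⟦ L′ ⟧ → cost c L ℚ.≤ cost c L′)

-- A sequence of 2k vertices; the position of the entry at i is index i ∈ {1,…,2k}.
Seq : ℕ → ℕ → ℕ → Set
Seq k m n = Fin (2 * k) → Vertex m n

index : Fin n → ℕ
index i = suc (toℕ i)

image : (Fin k → Vertex m n) → Pred (Vertex m n) 0ℓ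
image t v = ∃[ i ] t i ≡ v

-- In even-step and odd-step, j is the position directly after i, so an odd
-- index j is automatically at least 3.
record IsZigzag (k : ℕ) {m n : ℕ} (q : Seq k m n) : Set where
  field
    2≤k       : 2 ≤ k
    first     : ∀ i → index i ≡ 1 → row (q i) ≡ 1
    last      : ∀ i → index i ≡ 2 * k → row (q i) ≡ m
    even-step : ∀ i j → index j ≡ suc (index i) → 2 ∣ index j →
                col (q j) ≡ col (q i) × row (q i) < row (q j)
    odd-step  : ∀ i j → index j ≡ suc (index i) → ¬ 2 ∣ index j →
                row (q j) ≡ row (q i) × col (q i) < col (q j)

record Corresponds (k : ℕ) {m n : ℕ} (q t : Seq k m n) : Set where
  field
    first      : ∀ i → index i ≡ 1 → t i ≡ q i
    even       : ∀ i → 2 ∣ index i → row (t i) ≡ row (q i) × col (t i) ≤ col (q i)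
    odd        : ∀ i → ¬ 2 ∣ index i → 3 ≤ index i → col (t i) ≡ col (q i) × row (t i) ≤ row (q i)
    first<last : ∀ i j → index i ≡ 1 → index j ≡ 2 * k → col (t i) < col (t j)

IsPerfect : (k : ℕ) → Cost m n → (q t : Seq k m n) → Set
IsPerfect {m} {n} k c q t =
  Corresponds k q t ×
  ((t′ : Seq k m n) → Corresponds k q t′ → total c (tabulate t) ℚ.≤ total c (tabulate t′))

-- The eight renumberings of the m × n grid as an m′ × n′ grid: the corner that
-- becomes (1,1) is given by the two Booleans, the neighbour of it that becomes
-- (1,2) by the constructor.
data Renumbering (m n : ℕ) : ℕ → ℕ → Set where
  direct     : (flipRows flipCols : Bool) → Renumbering m n m n
  transposed : (flipRows flipCols : Bool) → Renumbering m n n m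

flipIf : Bool → Fin n → Fin n
flipIf true  i = opposite i
flipIf false i = i

-- The vertex of the original grid whose new number is the given one; sets and
-- costs are therefore carried along by precomposition with it.
original : Renumbering m n m′ n′ → Vertex m′ n′ → Vertex m n
original (direct     r s) (i , j) = flipIf r i , flipIf s j
original (transposed r s) (i , j) = flipIf r j , flipIf s i

{-# OPTIONS --safe #-}
module Submission where

-- A vertex x separates two vertices in the same row (column) unless it lies on
-- the bisecting column (row).  For any other pair, bisecting rows and columns
-- yields a cut of the grid into four quadrants such that every vertex of one
-- diagonal pair of quadrants separates the two, and pairs of neighbours on a
-- diagonal show that nothing less suffices.  So S is a landmark set iff for
-- every cut it meets both the diagonal and the antidiagonal pair of quadrants,
-- and it is not contained in an interior row or column.
--
-- For a sequence t corresponding to a zigzag sequence q, the vertices t₁ and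
-- t₂ₖ meet all diagonal pairs, and the path q cannot leave the upper left
-- quadrant of a cut without t meeting the antidiagonal pair.
--
-- Conversely, the cuts at the four corners force a landmark set L to meet two
-- opposite sides, say the top row in p and the bottom row in b, with
-- col p ≤ col b.  Either three vertices of L suffice, or p can be chosen
-- rightmost in the top row and all bottom vertices lie strictly to its right;
-- then alternately taking the lowest vertex weakly to the left of the last one
-- and the rightmost vertex weakly above that one, until the bottom row is
-- reached, yields a sequence corresponding to a zigzag sequence.  It is a
-- landmark set, hence all of L if L is minimal, and perfect if L has minimum
-- cost.

open import Defs
open import Data.Empty using (⊥-elim)
open import Data.Bool using (Bool; true; false; T?)
open import Data.Fin using (Fin; zero; suc; toℕ; fromℕ<; opposite)
open import Data.Fin.Properties as Finₚ using (toℕ<n; toℕ-fromℕ<; toℕ-injective; opposite-prop; opposite-involutive)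
open import Data.List using (List; []; _∷_; _++_; map; length; tabulate; filter; foldr; allFin; cartesianProduct)
open import Data.List.Extrema.Nat using (argmax; argmax-all; f[xs]≤f[argmax])
open import Data.List.Membership.Propositional using (_∈_; find; lose)
open import Data.List.Membership.Propositional.Properties
  using (∈-∃++; ∈-++⁺ˡ; ∈-++⁺ʳ; ∈-++⁻; ∈-allFin; ∈-cartesianProduct⁺; ∈-filter⁺; ∈-filter⁻; ∈-map⁺; ∈-map⁻; ∈-tabulate⁺; ∈-tabulate⁻)
import Data.List.Membership.DecPropositional as DecMembership
open import Data.List.Properties using (length-++; length-map; map-tabulate)
open import Data.List.Relation.Binary.Permutation.Propositional using (_↭_; ↭-refl; ↭-prep; ↭-trans; ↭⇒↭ₛ)
open import Data.List.Relation.Binary.Permutation.Propositional.Properties using (shift; ↭-length; map⁺)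
open import Data.List.Relation.Binary.Permutation.Setoid.Properties using (foldr-commMonoid)
open import Data.List.Relation.Unary.All as All using (All; []; _∷_)
open import Data.List.Relation.Unary.All.Properties using (all-filter)
open import Data.List.Relation.Unary.AllPairs using ([]; _∷_)
open import Data.List.Relation.Unary.Any using (here; there; any?)
open import Data.List.Relation.Unary.Unique.Propositional using (Unique)
import Data.List.Relation.Unary.Unique.Propositional.Properties as Uniqueₚ
open import Data.Nat using (ℕ; zero; suc; _+_; _*_; _∸_; _≤_; _<_; z≤n; s≤s; ∣_-_∣; ⌊_/2⌋; ⌈_/2⌉; _≤?_; _<?_; _≟_)
open import Data.Nat.Divisibility using (_∣_; _∣?_; ∣-refl; m∣m*n; n∣m*n; ∣1⇒≡1; ∣m+n∣m⇒∣n)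
open import Data.Nat.Properties
open import Data.Product as Product using (_×_; Σ-syntax; _,_; proj₁; proj₂; ∃-syntax)
open import Data.Product.Properties using (≡-dec)
open import Data.Rational as ℚ using (0ℚ)
import Data.Rational.Properties as ℚₚ
open import Data.Sum as Sum using (_⊎_; inj₁; inj₂)
open import Function using (_∘_; Injective)
open import Level using (0ℓ)
open import Relation.Binary.Definitions using (DecidableEquality; tri<; tri≈; tri>)
open import Relation.Binary.PropositionalEquality using (_≡_; _≢_; refl; sym; trans; cong; cong₂; subst; subst₂; setoid; module ≡-Reasoning)
open import Relation.Nullary using (¬_; yes; no; does; contradiction)
open import Relation.Nullary.Decidable using (decidable-stable; isYes; _×-dec_; toWitness; fromWitness)
open import Relation.Unary using (Pred; Decidable; _≐_)

private
  variable
    m n : ℕ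

-- Distances on a line

i+∣i-k∣≡k : ∀ {i k} → i ≤ k → i + ∣ i - k ∣ ≡ k
i+∣i-k∣≡k {i} i≤k = trans (cong (i +_) (m≤n⇒∣m-n∣≡n∸m i≤k)) (m+[n∸m]≡n i≤k)

-- Once `x` or `i` is zero, a triangle inequality suffices; otherwise all four points move down by
-- one.
∣-∣-Monge : ∀ {x y i k} → x ≤ y → i ≤ k → ∣ x - i ∣ + ∣ y - k ∣ ≤ ∣ y - i ∣ + ∣ x - k ∣
∣-∣-Monge {zero} {y} {i} {k} _ i≤k = begin
  i + ∣ y - k ∣                    ≤⟨ +-monoʳ-≤ i (∣-∣-triangle y i k) ⟩
  i + (∣ y - i ∣ + ∣ i - k ∣)      ≡⟨ +-assoc i ∣ y - i ∣ ∣ i - k ∣ ⟨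
  i + ∣ y - i ∣ + ∣ i - k ∣        ≡⟨ cong (_+ ∣ i - k ∣) (+-comm i ∣ y - i ∣) ⟩
  ∣ y - i ∣ + i + ∣ i - k ∣        ≡⟨ +-assoc ∣ y - i ∣ i ∣ i - k ∣ ⟩
  ∣ y - i ∣ + (i + ∣ i - k ∣)      ≡⟨ cong (∣ y - i ∣ +_) (i+∣i-k∣≡k i≤k) ⟩
  ∣ y - i ∣ + k                    ∎
  where open ≤-Reasoning
∣-∣-Monge {x@(suc _)} {y@(suc _)} {zero} {k} x≤y _ = begin
  x + ∣ y - k ∣                    ≤⟨ +-monoʳ-≤ x (∣-∣-triangle y x k) ⟩
  x + (∣ y - x ∣ + ∣ x - k ∣)      ≡⟨ +-assoc x ∣ y - x ∣ ∣ x - k ∣ ⟨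
  x + ∣ y - x ∣ + ∣ x - k ∣        ≡⟨ cong (λ z → x + z + ∣ x - k ∣) (∣-∣-comm y x) ⟩
  x + ∣ x - y ∣ + ∣ x - k ∣        ≡⟨ cong (_+ ∣ x - k ∣) (i+∣i-k∣≡k x≤y) ⟩
  y + ∣ x - k ∣                    ∎
  where open ≤-Reasoning
∣-∣-Monge {suc x} {suc y} {suc i} {suc k} (s≤s x≤y) (s≤s i≤k) = ∣-∣-Monge x≤y i≤k

∣i+a-i∣≡a : ∀ i a → ∣ i + a - i ∣ ≡ a
∣i+a-i∣≡a zero    a = ∣-∣-identityʳ a
∣i+a-i∣≡a (suc i) a = ∣i+a-i∣≡a i a

∣i-i+a∣≡a : ∀ i a → ∣ i - i + a ∣ ≡ a
∣i-i+a∣≡a zero    a = refl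
∣i-i+a∣≡a (suc i) a = ∣i-i+a∣≡a i a

module _ (i a b : ℕ) where

  private
    r k : ℕ
    r = i + a
    k = suc (r + b)

    i≤r : i ≤ r
    i≤r = m≤m+n i a

    r<k : r < k
    r<k = s≤s (m≤m+n r b)

    i≤k : i ≤ k
    i≤k = ≤-trans i≤r (<⇒≤ r<k)

  -- This is the Monge inequality for `x` and `r`, where `r` lies `a` steps after `i` and `suc b`
  -- steps before `k`.
  left-of-cut : ∀ {x} → x ≤ r → ∣ x - i ∣ + suc b ≤ a + ∣ x - k ∣
  left-of-cut {x} x≤r = subst₂ (λ p q → ∣ x - i ∣ + p ≤ q + ∣ x - k ∣)
    (trans (cong (λ z → ∣ r - z ∣) (sym (+-suc r b))) (∣i-i+a∣≡a r (suc b)))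
    (∣i+a-i∣≡a i a)
    (∣-∣-Monge x≤r i≤k)

  -- This is the Monge inequality for `suc r` and `x`, where `suc r` lies `suc a` steps after `i`
  -- and `b` steps before `k`.
  right-of-cut : ∀ {x} → r < x → suc a + ∣ x - k ∣ ≤ ∣ x - i ∣ + b
  right-of-cut {x} r<x = subst₂ (λ p q → p + ∣ x - k ∣ ≤ ∣ x - i ∣ + q)
    (trans (cong (λ z → ∣ z - i ∣) (sym (+-suc i a))) (∣i+a-i∣≡a i (suc a)))
    (∣i-i+a∣≡a r b)
    (∣-∣-Monge r<x i≤k)

⌈n/2⌉≤1+⌊n/2⌋ : ∀ n → ⌈ n /2⌉ ≤ suc ⌊ n /2⌋
⌈n/2⌉≤1+⌊n/2⌋ zero          = z≤n
⌈n/2⌉≤1+⌊n/2⌋ (suc zero)    = s≤s z≤n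
⌈n/2⌉≤1+⌊n/2⌋ (suc (suc n)) = s≤s (⌈n/2⌉≤1+⌊n/2⌋ n)

-- A cut of the line into the points nearer to i and those nearer to k; the
-- midpoint, if there is one, lies to the right of the cut.
bisect-tieʳ : ∀ {i k} → i < k → ∃[ r ] i ≤ r × r < k ×
  (∀ {x} → x ≤ r → ∣ x - i ∣ < ∣ x - k ∣) × (∀ {x} → r < x → ∣ x - k ∣ ≤ ∣ x - i ∣)
bisect-tieʳ {i} i<k with e , refl ← m≤n⇒∃[o]m+o≡n i<k = r , m≤m+n i a , r<k , nearer , farther
  where
  a = ⌊ e /2⌋
  b = ⌈ e /2⌉
  r = i + a
  r+b : r + b ≡ i + e
  r+b = trans (+-assoc i a b) (cong (i +_) (⌊n/2⌋+⌈n/2⌉≡n e))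
  r<k : r < suc (i + e)
  r<k = subst (λ z → r < suc z) r+b (s≤s (m≤m+n r b))
  nearer : ∀ {x} → x ≤ r → ∣ x - i ∣ < ∣ x - suc (i + e) ∣
  nearer {x} x≤r = +-cancelˡ-≤ b _ _ (begin
    b + suc ∣ x - i ∣        ≡⟨ +-suc b _ ⟩
    suc b + ∣ x - i ∣        ≡⟨ +-comm (suc b) _ ⟩
    ∣ x - i ∣ + suc b        ≤⟨ left-of-cut i a b x≤r ⟩
    a + ∣ x - suc (r + b) ∣  ≤⟨ +-monoˡ-≤ _ (⌊n/2⌋≤⌈n/2⌉ e) ⟩
    b + ∣ x - suc (r + b) ∣  ≡⟨ cong (λ z → b + ∣ x - suc z ∣) r+b ⟩
    b + ∣ x - suc (i + e) ∣  ∎)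
    where open ≤-Reasoning
  farther : ∀ {x} → r < x → ∣ x - suc (i + e) ∣ ≤ ∣ x - i ∣
  farther {x} r<x = +-cancelˡ-≤ b _ _ (begin
    b + ∣ x - suc (i + e) ∣      ≤⟨ +-monoˡ-≤ _ (⌈n/2⌉≤1+⌊n/2⌋ e) ⟩
    suc a + ∣ x - suc (i + e) ∣  ≡⟨ cong (λ z → suc a + ∣ x - suc z ∣) r+b ⟨
    suc a + ∣ x - suc (r + b) ∣  ≤⟨ right-of-cut i a b r<x ⟩
    ∣ x - i ∣ + b                ≡⟨ +-comm _ b ⟩
    b + ∣ x - i ∣                ∎)
    where open ≤-Reasoning

-- Here `a` is rounded up, so a midpoint falls to the left of the cut and strictness holds on the
-- right.
bisect-tieˡ : ∀ {i k} → i < k → ∃[ r ] i ≤ r × r < k ×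
  (∀ {x} → x ≤ r → ∣ x - i ∣ ≤ ∣ x - k ∣) × (∀ {x} → r < x → ∣ x - k ∣ < ∣ x - i ∣)
bisect-tieˡ {i} i<k with e , refl ← m≤n⇒∃[o]m+o≡n i<k = r , m≤m+n i a , r<k , nearer , farther
  where
  a = ⌈ e /2⌉
  b = ⌊ e /2⌋
  r = i + a
  r+b : r + b ≡ i + e
  r+b = trans (+-assoc i a b) (cong (i +_) (trans (+-comm a b) (⌊n/2⌋+⌈n/2⌉≡n e)))
  r<k : r < suc (i + e)
  r<k = subst (λ z → r < suc z) r+b (s≤s (m≤m+n r b))
  nearer : ∀ {x} → x ≤ r → ∣ x - i ∣ ≤ ∣ x - suc (i + e) ∣
  nearer {x} x≤r = +-cancelˡ-≤ a _ _ (begin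
    a + ∣ x - i ∣            ≤⟨ +-monoˡ-≤ _ (⌈n/2⌉≤1+⌊n/2⌋ e) ⟩
    suc b + ∣ x - i ∣        ≡⟨ +-comm (suc b) _ ⟩
    ∣ x - i ∣ + suc b        ≤⟨ left-of-cut i a b x≤r ⟩
    a + ∣ x - suc (r + b) ∣  ≡⟨ cong (λ z → a + ∣ x - suc z ∣) r+b ⟩
    a + ∣ x - suc (i + e) ∣  ∎)
    where open ≤-Reasoning
  farther : ∀ {x} → r < x → ∣ x - suc (i + e) ∣ < ∣ x - i ∣
  farther {x} r<x = +-cancelˡ-≤ a _ _ (begin
    a + suc ∣ x - suc (i + e) ∣  ≡⟨ +-suc a _ ⟩
    suc a + ∣ x - suc (i + e) ∣  ≡⟨ cong (λ z → suc a + ∣ x - suc z ∣) r+b ⟨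
    suc a + ∣ x - suc (r + b) ∣  ≤⟨ right-of-cut i a b r<x ⟩
    ∣ x - i ∣ + b                ≤⟨ +-monoʳ-≤ _ (⌊n/2⌋≤⌈n/2⌉ e) ⟩
    ∣ x - i ∣ + a                ≡⟨ +-comm _ a ⟩
    a + ∣ x - i ∣                ∎)
    where open ≤-Reasoning

equidistant⇒between : ∀ x {i k} → i < k → ∣ x - i ∣ ≡ ∣ x - k ∣ → i < x × x < k
equidistant⇒between zero  {i} {k} i<k refl = contradiction i<k (<-irrefl refl)
equidistant⇒between (suc x) {zero} {suc k} _ eq = s≤s z≤n , s≤s (≰⇒> k≰x)
  where
  k≰x : ¬ k ≤ x
  k≰x k≤x = <-irrefl (sym eq) (s≤s (≤-trans (≤-reflexive (trans (∣-∣-comm x k) (m≤n⇒∣m-n∣≡n∸m k≤x))) (m∸n≤m x k)))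
equidistant⇒between (suc x) {suc i} {suc k} (s≤s i<k) eq with p , q ← equidistant⇒between x i<k eq = s≤s p , s≤s q

-- The point lies strictly between, so adding one and the same distance leads from `i` to `x` and
-- from `x` to `k`.
equidistant⇒x+x≡i+k : ∀ x {i k} → i < k → ∣ x - i ∣ ≡ ∣ x - k ∣ → x + x ≡ i + k
equidistant⇒x+x≡i+k x {i} {k} i<k eq with i<x , x<k ← equidistant⇒between x i<k eq = begin
  x + x                    ≡⟨ cong (x +_) (i+∣i-k∣≡k (<⇒≤ i<x)) ⟨
  x + (i + ∣ i - x ∣)      ≡⟨ +-assoc x i _ ⟨
  x + i + ∣ i - x ∣        ≡⟨ cong₂ _+_ (+-comm x i) (trans (∣-∣-comm i x) eq) ⟩
  i + x + ∣ x - k ∣        ≡⟨ +-assoc i x _ ⟩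
  i + (x + ∣ x - k ∣)      ≡⟨ cong (i +_) (i+∣i-k∣≡k (<⇒≤ x<k)) ⟩
  i + k                    ∎
  where open ≡-Reasoning

equidistant-unique : ∀ x y {i k} → i < k → ∣ x - i ∣ ≡ ∣ x - k ∣ → ∣ y - i ∣ ≡ ∣ y - k ∣ → x ≡ y
equidistant-unique x y i<k p q
  with eq ← trans (equidistant⇒x+x≡i+k x i<k p) (sym (equidistant⇒x+x≡i+k y i<k q))
  with <-cmp x y
... | tri< x<y _ _ = contradiction eq (<⇒≢ (+-mono-< x<y x<y))
... | tri≈ _ x≡y _ = x≡y
... | tri> _ _ y<x = contradiction (sym eq) (<⇒≢ (+-mono-< y<x y<x))

-- Landmark sets and cuts of the grid

-- A pair (r , d) cuts the grid between rows r and r + 1 and between columns d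
-- and d + 1 into four quadrants.
InDiagonal InAntidiagonal : ℕ → ℕ → Vertex m n → Set
InDiagonal     r d x = (row x ≤ r × col x ≤ d) ⊎ (r < row x × d < col x)
InAntidiagonal r d x = (row x ≤ r × d < col x) ⊎ (r < row x × col x ≤ d)

-- The bounds make every cut proper, with four nonempty quadrants. Only interior lines occur in the
-- last two fields, since a border row or column bisects no pair of vertices.
record MeetsCuts {m n : ℕ} (S : Pred (Vertex m n) 0ℓ) : Set where
  field
    diagonal     : ∀ {r d} → 1 ≤ r → r < m → 1 ≤ d → d < n → ∃[ x ] S x × InDiagonal r d x
    antidiagonal : ∀ {r d} → 1 ≤ r → r < m → 1 ≤ d → d < n → ∃[ x ] S x × InAntidiagonal r d x
    off-row      : ∀ {r} → 1 < r → r < m → ∃[ x ] S x × row x ≢ r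
    off-col      : ∀ {d} → 1 < d → d < n → ∃[ x ] S x × col x ≢ d

row≤m : (v : Vertex m n) → row v ≤ m
row≤m (i , _) = toℕ<n i

col≤n : (v : Vertex m n) → col v ≤ n
col≤n (_ , j) = toℕ<n j

row-col-injective : {u v : Vertex m n} → row u ≡ row v → col u ≡ col v → u ≡ v
row-col-injective p q = cong₂ _,_ (toℕ-injective (suc-injective p)) (toℕ-injective (suc-injective q))

module _ {S : Pred (Vertex m n) 0ℓ} (2≤m : 2 ≤ m) (2≤n : 2 ≤ n) (cuts : MeetsCuts S) where
  open MeetsCuts cuts

  private
    -- Any vertex of `S` serves as a first try; the corner cut supplies one. If it fails, its column
    -- is the unique bisecting one, hence interior, and a vertex of `S` off that column separates.
    separated-in-row : (u v : Vertex m n) → row u ≡ row v → col u < col v → ∃[ x ] S x × Separates x u v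
    separated-in-row u v r≡ c< with x , x∈S , _ ← diagonal ≤-refl 2≤m ≤-refl 2≤n
      | ∣ col x - col u ∣ ≟ ∣ col x - col v ∣
    ... | no  c≢ = x , x∈S , λ e → c≢ (+-cancelˡ-≡ ∣ row x - row u ∣ _ _ (trans e (cong (λ z → ∣ row x - z ∣ + ∣ col x - col v ∣) (sym r≡))))
    ... | yes c≡ with u<x , x<v ← equidistant⇒between (col x) c< c≡
      with y , y∈S , y≢x ← off-col (≤-<-trans (s≤s z≤n) u<x) (<-≤-trans x<v (col≤n v)) =
      y , y∈S , λ e → y≢x (equidistant-unique (col y) (col x) c<
        (+-cancelˡ-≡ ∣ row y - row u ∣ _ _ (trans e (cong (λ z → ∣ row y - z ∣ + ∣ col y - col v ∣) (sym r≡)))) c≡)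

    separated-in-col : (u v : Vertex m n) → row u < row v → col u ≡ col v → ∃[ x ] S x × Separates x u v
    separated-in-col u v r< c≡ with x , x∈S , _ ← diagonal ≤-refl 2≤m ≤-refl 2≤n
      | ∣ row x - row u ∣ ≟ ∣ row x - row v ∣
    ... | no  r≢ = x , x∈S , λ e → r≢ (+-cancelʳ-≡ ∣ col x - col u ∣ _ _ (trans e (cong (λ z → ∣ row x - row v ∣ + ∣ col x - z ∣) (sym c≡))))
    ... | yes r≡ with u<x , x<v ← equidistant⇒between (row x) r< r≡
      with y , y∈S , y≢x ← off-row (≤-<-trans (s≤s z≤n) u<x) (<-≤-trans x<v (row≤m v)) =
      y , y∈S , λ e → y≢x (equidistant-unique (row y) (row x) r<
        (+-cancelʳ-≡ ∣ col y - col u ∣ _ _ (trans e (cong (λ z → ∣ row y - row v ∣ + ∣ col y - z ∣) (sym c≡)))) r≡)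

    -- Ties are broken in opposite directions for rows and columns, so in either diagonal quadrant
    -- one comparison of distances is strict and the other weak, both in the same sense.
    separated-diagonal : (u v : Vertex m n) → row u < row v → col u < col v → ∃[ x ] S x × Separates x u v
    separated-diagonal u v r< c<
      with r , u≤r , r<v , up , down ← bisect-tieʳ r<
      with d , u≤d , d<v , left , right ← bisect-tieˡ c<
      with diagonal (≤-trans (s≤s z≤n) u≤r) (<-≤-trans r<v (row≤m v)) (≤-trans (s≤s z≤n) u≤d) (<-≤-trans d<v (col≤n v))
    ... | x , x∈S , inj₁ (p , q) = x , x∈S , <⇒≢ (+-mono-<-≤ (up p) (left q))
    ... | x , x∈S , inj₂ (p , q) = x , x∈S , <⇒≢ (+-mono-≤-< (down p) (right q)) ∘ sym

    -- The columns of `u` and `v` come in reverse order, so ties now go the same way for rows and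
    -- columns.
    separated-antidiagonal : (u v : Vertex m n) → row u < row v → col v < col u → ∃[ x ] S x × Separates x u v
    separated-antidiagonal u v r< c<
      with r , u≤r , r<v , up , down ← bisect-tieʳ r<
      with d , v≤d , d<u , left , right ← bisect-tieʳ c<
      with antidiagonal (≤-trans (s≤s z≤n) u≤r) (<-≤-trans r<v (row≤m v)) (≤-trans (s≤s z≤n) v≤d) (<-≤-trans d<u (col≤n u))
    ... | x , x∈S , inj₁ (p , q) = x , x∈S , <⇒≢ (+-mono-<-≤ (up p) (right q))
    ... | x , x∈S , inj₂ (p , q) = x , x∈S , <⇒≢ (+-mono-≤-< (down p) (left q)) ∘ sym

    swap : {u v : Vertex m n} → ∃[ x ] S x × Separates x u v → ∃[ x ] S x × Separates x v u
    swap (x , x∈S , sep) = x , x∈S , sep ∘ sym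

  meetsCuts⇒landmark : IsLandmark S
  meetsCuts⇒landmark u v u≢v with <-cmp (row u) (row v) | <-cmp (col u) (col v)
  ... | tri≈ _ r≡ _ | tri≈ _ c≡ _ = contradiction (row-col-injective r≡ c≡) u≢v
  ... | tri≈ _ r≡ _ | tri< c< _ _ = separated-in-row u v r≡ c<
  ... | tri≈ _ r≡ _ | tri> _ _ c> = swap (separated-in-row v u (sym r≡) c>)
  ... | tri< r< _ _ | tri≈ _ c≡ _ = separated-in-col u v r< c≡
  ... | tri> _ _ r> | tri≈ _ c≡ _ = swap (separated-in-col v u r> (sym c≡))
  ... | tri< r< _ _ | tri< c< _ _ = separated-diagonal u v r< c<
  ... | tri> _ _ r> | tri> _ _ c> = swap (separated-diagonal v u r> c>)
  ... | tri< r< _ _ | tri> _ _ c> = separated-antidiagonal u v r< c>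
  ... | tri> _ _ r> | tri< c< _ _ = swap (separated-antidiagonal v u r> c<)

-- Cuts met by a landmark set

vertex-at : ∀ {r d} → 1 ≤ r → r ≤ m → 1 ≤ d → d ≤ n → Σ[ v ∈ Vertex m n ] row v ≡ r × col v ≡ d
vertex-at (s≤s _) r≤m (s≤s _) d≤n =
  (fromℕ< r≤m , fromℕ< d≤n) , cong suc (toℕ-fromℕ< r≤m) , cong suc (toℕ-fromℕ< d≤n)

∣x-1+r∣ : ∀ {x r} → x ≤ r → ∣ x - suc r ∣ ≡ suc ∣ x - r ∣
∣x-1+r∣ z≤n     = refl
∣x-1+r∣ (s≤s p) = ∣x-1+r∣ p

∣x-r∣ : ∀ {x r} → r < x → ∣ x - r ∣ ≡ suc ∣ x - suc r ∣
∣x-r∣ {suc x} {zero}  _       = cong suc (sym (∣-∣-identityʳ x))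
∣x-r∣ {suc x} {suc r} (s≤s p) = ∣x-r∣ p

module _ {S : Pred (Vertex m n) 0ℓ} (landmark : IsLandmark S) where

  private
    separate : ∀ {r d r′ d′} → 1 ≤ r → r ≤ m → 1 ≤ d → d ≤ n → 1 ≤ r′ → r′ ≤ m → 1 ≤ d′ → d′ ≤ n → d ≢ d′ →
      ∃[ x ] S x × ∣ row x - r ∣ + ∣ col x - d ∣ ≢ ∣ row x - r′ ∣ + ∣ col x - d′ ∣
    separate 1≤r r≤m 1≤d d≤n 1≤r′ r′≤m 1≤d′ d′≤n d≢d′
      with u , refl , refl ← vertex-at 1≤r r≤m 1≤d d≤n
      with v , refl , refl ← vertex-at 1≤r′ r′≤m 1≤d′ d′≤n = landmark u v λ u≡v → d≢d′ (cong col u≡v)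

  -- The vertices `(r , d)` and `(suc r , suc d)` are equidistant from all vertices of the
  -- antidiagonal quadrants: the unit gained in one coordinate is lost in the other.
  landmark⇒diagonal : ∀ {r d} → 1 ≤ r → r < m → 1 ≤ d → d < n → ∃[ x ] S x × InDiagonal r d x
  landmark⇒diagonal {r} {d} 1≤r r<m 1≤d d<n
    with x , x∈S , sep ← separate 1≤r (<⇒≤ r<m) 1≤d (<⇒≤ d<n) (s≤s z≤n) r<m (s≤s z≤n) d<n (1+n≢n ∘ sym)
    with row x ≤? r | col x ≤? d
  ... | yes p | yes q = x , x∈S , inj₁ (p , q)
  ... | no  p | no  q = x , x∈S , inj₂ (≰⇒> p , ≰⇒> q)
  ... | yes p | no  q = ⊥-elim (sep (trans (cong (∣ row x - r ∣ +_) (∣x-r∣ (≰⇒> q)))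
                          (trans (+-suc _ _) (cong (_+ ∣ col x - suc d ∣) (sym (∣x-1+r∣ p))))))
  ... | no  p | yes q = ⊥-elim (sep (trans (cong (_+ ∣ col x - d ∣) (∣x-r∣ (≰⇒> p)))
                          (trans (sym (+-suc _ _)) (cong (∣ row x - suc r ∣ +_) (sym (∣x-1+r∣ q))))))

  landmark⇒antidiagonal : ∀ {r d} → 1 ≤ r → r < m → 1 ≤ d → d < n → ∃[ x ] S x × InAntidiagonal r d x
  landmark⇒antidiagonal {r} {d} 1≤r r<m 1≤d d<n
    with x , x∈S , sep ← separate 1≤r (<⇒≤ r<m) (s≤s z≤n) d<n (s≤s z≤n) r<m 1≤d (<⇒≤ d<n) 1+n≢n
    with row x ≤? r | col x ≤? d
  ... | yes p | no  q = x , x∈S , inj₁ (p , ≰⇒> q)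
  ... | no  p | yes q = x , x∈S , inj₂ (≰⇒> p , q)
  ... | yes p | yes q = ⊥-elim (sep (trans (cong (∣ row x - r ∣ +_) (∣x-1+r∣ q))
                          (trans (+-suc _ _) (cong (_+ ∣ col x - d ∣) (sym (∣x-1+r∣ p))))))
  ... | no  p | no  q = ⊥-elim (sep (trans (cong (_+ ∣ col x - suc d ∣) (∣x-r∣ (≰⇒> p)))
                          (trans (sym (+-suc _ _)) (cong (∣ row x - suc r ∣ +_) (sym (∣x-r∣ (≰⇒> q)))))))

  -- The two neighbours, in row 1, of the vertex of that row in the given column are equidistant
  -- from every vertex of the column.
  landmark⇒off-col : ∀ {d} → 1 ≤ m → 1 < d → d < n → ∃[ x ] S x × col x ≢ d
  landmark⇒off-col {suc d} 1≤m (s≤s 1≤d) d<n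
    with x , x∈S , sep ← separate ≤-refl 1≤m 1≤d (≤-trans (n≤1+n d) (<⇒≤ d<n)) ≤-refl 1≤m (s≤s z≤n) d<n (m≢1+n+m d) =
    x , x∈S , λ c≡ → sep (cong (∣ row x - 1 ∣ +_) (equal c≡))
    where
    equal : ∀ {c} → c ≡ suc d → ∣ c - d ∣ ≡ ∣ c - suc (suc d) ∣
    equal refl = trans (∣x-r∣ (n<1+n d)) (sym (∣x-1+r∣ {suc d} ≤-refl))

module _ {S : Pred (Vertex m n) 0ℓ} {p b : Vertex m n} (p∈S : S p) (b∈S : S b) (top : row p ≡ 1) (bottom : row b ≡ m) where

  private
    above : ∀ {r} → 1 ≤ r → row p ≤ r
    above 1≤r = ≤-trans (≤-reflexive top) 1≤r

    below : ∀ {r} → r < m → r < row b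
    below r<m = <-≤-trans r<m (≤-reflexive (sym bottom))

  -- Every cut has `p` above and `b` below it. If `p` is not to its left, then `b` is to its right.
  top-bottom-diagonal : col p ≤ col b → ∀ {r d} → 1 ≤ r → r < m → ∃[ x ] S x × InDiagonal r d x
  top-bottom-diagonal p≤b {d = d} 1≤r r<m with col p ≤? d
  ... | yes p≤d = p , p∈S , inj₁ (above 1≤r , p≤d)
  ... | no  p≰d = b , b∈S , inj₂ (below r<m , <-≤-trans (≰⇒> p≰d) p≤b)

  top-bottom-antidiagonal : col b ≤ col p → ∀ {r d} → 1 ≤ r → r < m → ∃[ x ] S x × InAntidiagonal r d x
  top-bottom-antidiagonal b≤p {d = d} 1≤r r<m with col b ≤? d
  ... | yes b≤d = b , b∈S , inj₂ (below r<m , b≤d)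
  ... | no  b≰d = p , p∈S , inj₁ (above 1≤r , <-≤-trans (≰⇒> b≰d) b≤p)

top-off-row : {S : Pred (Vertex m n) 0ℓ} {p : Vertex m n} → S p → row p ≡ 1 →
  ∀ {r} → 1 < r → r < m → ∃[ x ] S x × row x ≢ r
top-off-row {p = p} p∈S top 1<r _ = p , p∈S , λ eq → <⇒≢ 1<r (trans (sym top) eq)

two-columns-off-col : {S : Pred (Vertex m n) 0ℓ} {p b : Vertex m n} → S p → S b → col p ≢ col b →
  ∀ {d} → 1 < d → d < n → ∃[ x ] S x × col x ≢ d
two-columns-off-col {p = p} {b} p∈S b∈S p≢b {d} _ _ with col p ≟ d
... | yes refl = b , b∈S , p≢b ∘ sym
... | no  p≢d  = p , p∈S , p≢d

-- Zigzag sequences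

odd⇒≡1⊎≥3 : ∀ {i} → ¬ 2 ∣ i → 1 ≤ i → i ≡ 1 ⊎ 3 ≤ i
odd⇒≡1⊎≥3 {suc zero}          _   _ = inj₁ refl
odd⇒≡1⊎≥3 {suc (suc zero)}    odd _ = contradiction ∣-refl odd
odd⇒≡1⊎≥3 {suc (suc (suc _))} _   _ = inj₂ (s≤s (s≤s (s≤s z≤n)))

module _ {k : ℕ} {q t : Seq k m n} (zigzag : IsZigzag k q) (corresponds : Corresponds k q t) where
  private
    module Z = IsZigzag zigzag
    module C = Corresponds corresponds

    0<2k : 0 < 2 * k
    0<2k = ≤-trans (≤-trans (s≤s z≤n) Z.2≤k) (m≤m+n k _)

    -- Positions are counted from zero but `index` from one, so the last entry sits at position
    -- `2 * k ∸ 1`.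
    at : ∀ {i} → i < 2 * k → Fin (2 * k)
    at i< = fromℕ< i<

    index-at : ∀ {i} (i< : i < 2 * k) → index (at i<) ≡ suc i
    index-at i< = cong suc (toℕ-fromℕ< i<)

    next : ∀ {i} (i< : i < 2 * k) (1+i< : suc i < 2 * k) → index (at 1+i<) ≡ suc (index (at i<))
    next i< 1+i< = trans (index-at 1+i<) (cong suc (sym (index-at i<)))

    3≤index : ∀ {i j : Fin (2 * k)} → index j ≡ suc (index i) → ¬ 2 ∣ index j → 3 ≤ index j
    3≤index j≡ odd with odd⇒≡1⊎≥3 odd (s≤s z≤n)
    ... | inj₁ j≡1 = contradiction (suc-injective (trans (sym j≡) j≡1)) 1+n≢0
    ... | inj₂ 3≤j = 3≤j

    last< : 2 * k ∸ 1 < 2 * k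
    last< = ≤-reflexive (m+[n∸m]≡n 0<2k)

    first-index : index (at 0<2k) ≡ 1
    first-index = index-at 0<2k

    last-index : index (at last<) ≡ 2 * k
    last-index = trans (index-at last<) (m+[n∸m]≡n 0<2k)

    t-first-row : row (t (at 0<2k)) ≡ 1
    t-first-row = trans (cong row (C.first _ first-index)) (Z.first _ first-index)

    t-last-row : row (t (at last<)) ≡ m
    t-last-row = trans (proj₁ (C.even _ (subst (2 ∣_) (sym last-index) (m∣m*n k)))) (Z.last _ last-index)

    t-first<last : col (t (at 0<2k)) < col (t (at last<))
    t-first<last = C.first<last _ _ first-index last-index

    -- An even step descends in a column, an odd one moves right in a row. When it crosses the cut,
    -- `t j` shares the coordinate of `q j` that crossed, while its other coordinate is at most that
    -- of `q i`.
    stay : ∀ {r d} i j → index j ≡ suc (index i) → row (q i) ≤ r × col (q i) ≤ d →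
      (∃[ x ] image t x × InAntidiagonal r d x) ⊎ (row (q j) ≤ r × col (q j) ≤ d)
    stay {r} {d} i j j≡ (q≤r , q≤d) with 2 ∣? index j
    ... | yes even with c≡ , _ ← Z.even-step i j j≡ even | t≡ , t≤ ← C.even j even | row (q j) ≤? r
    ...   | yes q≤r′ = inj₂ (q≤r′ , ≤-trans (≤-reflexive c≡) q≤d)
    ...   | no  q≰r  = inj₁ (t j , (j , refl) ,
              inj₂ (<-≤-trans (≰⇒> q≰r) (≤-reflexive (sym t≡)) , ≤-trans t≤ (≤-trans (≤-reflexive c≡) q≤d)))
    stay {r} {d} i j j≡ (q≤r , q≤d) | no odd
      with r≡ , _ ← Z.odd-step i j j≡ odd | t≡ , t≤ ← C.odd j odd (3≤index {i} j≡ odd) | col (q j) ≤? d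
    ...   | yes q≤d′ = inj₂ (≤-trans (≤-reflexive r≡) q≤r , q≤d′)
    ...   | no  q≰d  = inj₁ (t j , (j , refl) ,
              inj₁ (≤-trans t≤ (≤-trans (≤-reflexive r≡) q≤r) , <-≤-trans (≰⇒> q≰d) (≤-reflexive (sym t≡))))

    -- The path q starts to the right of the cut or in its upper left quadrant,
    -- which it has to leave; whichever way it does so, the entry of t there
    -- lies in the antidiagonal quadrant entered.
    follow : ∀ {r d i} → 1 ≤ r → (i< : i < 2 * k) →
      (∃[ x ] image t x × InAntidiagonal r d x) ⊎ (row (q (at i<)) ≤ r × col (q (at i<)) ≤ d)
    follow {r} {d} {zero} 1≤r i< with col (q (at i<)) ≤? d
    ... | yes c≤d = inj₂ (≤-trans (≤-reflexive (Z.first _ (index-at i<))) 1≤r , c≤d)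
    ... | no  c≰d = inj₁ (q (at i<) , (_ , C.first _ (index-at i<)) ,
        inj₁ (≤-trans (≤-reflexive (Z.first _ (index-at i<))) 1≤r , ≰⇒> c≰d))
    follow {r} {d} {suc i} 1≤r 1+i< =
      Sum.[ inj₁ , stay (at i<) (at 1+i<) (next i< 1+i<) ] (follow 1≤r i<)
      where
      i< : i < 2 * k
      i< = <-trans (n<1+n i) 1+i<

  corresponding-meetsCuts : MeetsCuts (image t)
  corresponding-meetsCuts = record
    { diagonal     = λ 1≤r r<m _ _ → top-bottom-diagonal (_ , refl) (_ , refl) t-first-row t-last-row (<⇒≤ t-first<last) 1≤r r<m
    -- At the last position the path is in the bottom row, so it has left the upper left quadrant.
    ; antidiagonal = λ 1≤r r<m _ _ → Sum.[ (λ found → found)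
                     , (λ (q≤r , _) → contradiction (≤-trans (≤-reflexive (sym (Z.last _ last-index))) q≤r) (<⇒≱ r<m)) ] (follow 1≤r last<)
    ; off-row      = top-off-row (_ , refl) t-first-row
    ; off-col      = two-columns-off-col (_ , refl) (_ , refl) (<⇒≢ t-first<last)
    }

  private
    t≤q : ∀ i → row (t i) ≤ row (q i) × col (t i) ≤ col (q i)
    t≤q i with 2 ∣? index i
    ... | yes even with r≡ , c≤ ← C.even i even = ≤-reflexive r≡ , c≤
    ... | no  odd with odd⇒≡1⊎≥3 odd (s≤s z≤n)
    ...   | inj₁ i≡1 with eq ← C.first i i≡1 = ≤-reflexive (cong row eq) , ≤-reflexive (cong col eq)
    ...   | inj₂ 3≤i with c≡ , r≤ ← C.odd i odd 3≤i = r≤ , ≤-reflexive c≡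

    q-step : ∀ i j → index j ≡ suc (index i) → row (q i) ≤ row (q j) × col (q i) ≤ col (q j)
    q-step i j eq with 2 ∣? index j
    ... | yes even with c≡ , r< ← Z.even-step i j eq even = <⇒≤ r< , ≤-reflexive (sym c≡)
    ... | no  odd  with r≡ , c< ← Z.odd-step i j eq odd = ≤-reflexive (sym r≡) , <⇒≤ c<

    before : ∀ {l} (j : Fin (2 * k)) → toℕ j ≡ suc l → Σ[ i ∈ Fin (2 * k) ] toℕ i ≡ l
    before {l} j eq = fromℕ< l< , toℕ-fromℕ< l<
      where
      l< : l < 2 * k
      l< = <-trans (n<1+n l) (subst (_< 2 * k) eq (toℕ<n j))

    q-mono : ∀ e i j → toℕ j ≡ e + toℕ i → row (q i) ≤ row (q j) × col (q i) ≤ col (q j)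
    q-mono zero    i j eq with refl ← toℕ-injective eq = ≤-refl , ≤-refl
    q-mono (suc e) i j eq with j′ , eq′ ← before j eq
      with r≤ , c≤ ← q-mono e i j′ eq′ | r≤′ , c≤′ ← q-step j′ j (cong suc (trans eq (cong suc (sym eq′)))) =
      ≤-trans r≤ r≤′ , ≤-trans c≤ c≤′

    -- Let `j′` directly precede `j`. Both coordinates of `t i` are bounded by those of `q i`, hence
    -- of `q j′`, whereas `t j` exceeds `q j′` strictly in its row (even index) or column (odd
    -- index).
    t-distinct : ∀ {i j} → toℕ i < toℕ j → t i ≢ t j
    t-distinct {i} {j} i<j ti≡tj with e , eq ← m≤n⇒∃[o]m+o≡n i<j
      with j′ , eq′ ← before j (sym eq)
      with r≤ , c≤ ← q-mono e i j′ (trans eq′ (+-comm (toℕ i) e)) | tr≤ , tc≤ ← t≤q i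
      with j≡ ← cong suc (trans (sym eq) (cong suc (sym eq′)))
      with 2 ∣? index j
    ... | yes even = <⇒≢ (≤-<-trans (≤-trans tr≤ r≤)
            (<-≤-trans (proj₂ (Z.even-step j′ j j≡ even)) (≤-reflexive (sym (proj₁ (C.even j even)))))) (cong row ti≡tj)
    ... | no  odd = <⇒≢ (≤-<-trans (≤-trans tc≤ c≤)
            (<-≤-trans (proj₂ (Z.odd-step j′ j j≡ odd)) (≤-reflexive (sym (proj₁ (C.odd j odd (3≤index {j′} j≡ odd))))))) (cong col ti≡tj)

  corresponding-injective : Injective _≡_ _≡_ t
  corresponding-injective {i} {j} ti≡tj with <-cmp (toℕ i) (toℕ j)
  ... | tri< i<j _ _ = contradiction ti≡tj (t-distinct i<j)
  ... | tri≈ _ i≡j _ = toℕ-injective i≡j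
  ... | tri> _ _ j<i = contradiction (sym ti≡tj) (t-distinct j<i)

-- Finite sets of vertices

allVertices : (m n : ℕ) → List (Vertex m n)
allVertices m n = cartesianProduct (allFin m) (allFin n)

∈-allVertices : (v : Vertex m n) → v ∈ allVertices m n
∈-allVertices (i , j) = ∈-cartesianProduct⁺ (∈-allFin i) (∈-allFin j)

_≟ᵥ_ : DecidableEquality (Vertex m n)
_≟ᵥ_ = ≡-dec Finₚ._≟_ Finₚ._≟_

open module Membership {m n : ℕ} = DecMembership (_≟ᵥ_ {m} {n}) using (_∈?_)

module _ {P : Pred (Vertex m n) 0ℓ} (P? : Decidable P) (f : Vertex m n → ℕ) where

  -- The first argument is the junk value for an empty P.
  maximise : Vertex m n → Vertex m n
  maximise v = argmax f v (filter P? (allVertices m n))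

  maximise-∈ : ∀ {v} → P v → P (maximise v)
  maximise-∈ Pv = argmax-all f Pv (all-filter P? (allVertices m n))

  maximise-max : ∀ {v w} → P w → f w ≤ f (maximise v)
  maximise-max {v} Pw = All.lookup (f[xs]≤f[argmax] v (filter P? (allVertices m n))) (∈-filter⁺ P? (∈-allVertices _) Pw)

-- Extraction of a zigzag sequence

-- Because positions start at zero, `f` supplies the entries of odd index and `g` those of even
-- index.
interleave : {A : Set} → (ℕ → A) → (ℕ → A) → ℕ → A
interleave f g zero          = f 0
interleave f g (suc zero)    = g 0
interleave f g (suc (suc i)) = interleave (f ∘ suc) (g ∘ suc) i

interleave-even : {A : Set} (f g : ℕ → A) → ∀ l {i} → i ≡ l * 2 → interleave f g i ≡ f l
interleave-even f g zero    refl = refl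
interleave-even f g (suc l) refl = interleave-even (f ∘ suc) (g ∘ suc) l refl

interleave-odd : {A : Set} (f g : ℕ → A) → ∀ l {i} → i ≡ suc (l * 2) → interleave f g i ≡ g l
interleave-odd f g zero    refl = refl
interleave-odd f g (suc l) refl = interleave-odd (f ∘ suc) (g ∘ suc) l refl

interleave-all : {A : Set} (P : Pred A 0ℓ) (f g : ℕ → A) → (∀ l → P (f l)) → (∀ l → P (g l)) → ∀ i → P (interleave f g i)
interleave-all P f g Pf Pg zero          = Pf 0
interleave-all P f g Pf Pg (suc zero)    = Pg 0
interleave-all P f g Pf Pg (suc (suc i)) = interleave-all P (f ∘ suc) (g ∘ suc) (Pf ∘ suc) (Pg ∘ suc) i

halve : ∀ i → (∃[ l ] i ≡ l * 2) ⊎ (∃[ l ] i ≡ suc (l * 2))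
halve zero    = inj₁ (0 , refl)
halve (suc i) with halve i
... | inj₁ (l , eq) = inj₂ (l , cong suc eq)
... | inj₂ (l , eq) = inj₁ (suc l , cong suc eq)

2∤1+l*2 : ∀ l → ¬ 2 ∣ suc (l * 2)
2∤1+l*2 l 2∣ = contradiction (∣1⇒≡1 (∣m+n∣m⇒∣n (subst (2 ∣_) (+-comm 1 (l * 2)) 2∣) (n∣m*n l))) λ ()

even-position : ∀ {i} → 2 ∣ suc i → ∃[ l ] i ≡ suc (l * 2)
even-position {i} 2∣ with halve i
... | inj₁ (l , refl) = contradiction 2∣ (2∤1+l*2 l)
... | inj₂ half       = half

odd-position : ∀ {i} → ¬ 2 ∣ suc i → ∃[ l ] i ≡ l * 2
odd-position {i} 2∤ with halve i
... | inj₁ half       = half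
... | inj₂ (l , refl) = contradiction (n∣m*n (suc l)) 2∤

-- Only membership in `L` is recorded; equality with `L` and perfection follow later from minimality
-- and minimum cost.
ZigzagIn : VertexSet m n → Set
ZigzagIn {m} {n} L = Σ[ k ∈ ℕ ] Σ[ q ∈ Seq k m n ] Σ[ t ∈ Seq k m n ]
  IsZigzag k q × Corresponds k q t × (∀ i → ⟦ L ⟧ (t i))

module Staircase (L : VertexSet m n) (landmark : IsLandmark ⟦ L ⟧) (2≤m : 2 ≤ m)
  {p b : Vertex m n} (p∈L : ⟦ L ⟧ p) (b∈L : ⟦ L ⟧ b) (top : row p ≡ 1) (bottom : row b ≡ m)
  (p-rightmost : ∀ {w} → ⟦ L ⟧ w → row w ≡ 1 → col w ≤ col p)
  (bottom-right : ∀ {w} → ⟦ L ⟧ w → row w ≡ m → col p < col w) where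

  LeftOf UpOf : Vertex m n → Pred (Vertex m n) 0ℓ
  LeftOf v w = ⟦ L ⟧ w × col w ≤ col v
  UpOf   v w = ⟦ L ⟧ w × row w ≤ row v

  lowest rightmost : Vertex m n → Vertex m n
  lowest    v = maximise {P = LeftOf v} (λ w → T? (L w) ×-dec col w ≤? col v) row v
  rightmost v = maximise {P = UpOf v} (λ w → T? (L w) ×-dec row w ≤? row v) col v

  lowest-∈ : ∀ {v} → ⟦ L ⟧ v → LeftOf v (lowest v)
  lowest-∈ {v} v∈L = maximise-∈ {P = LeftOf v} _ row (v∈L , ≤-refl)

  rightmost-∈ : ∀ {v} → ⟦ L ⟧ v → UpOf v (rightmost v)
  rightmost-∈ {v} v∈L = maximise-∈ {P = UpOf v} _ col (v∈L , ≤-refl)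

  -- These become the entries of index `2 * l + 1` and `2 * l + 2`.
  odds evens : ℕ → Vertex m n
  odds zero    = p
  odds (suc l) = rightmost (evens l)
  evens l = lowest (odds l)

  odds-∈ : ∀ l → ⟦ L ⟧ (odds l)
  evens-∈ : ∀ l → ⟦ L ⟧ (evens l)
  odds-∈ zero    = p∈L
  odds-∈ (suc l) = proj₁ (rightmost-∈ (evens-∈ l))
  evens-∈ l = proj₁ (lowest-∈ (odds-∈ l))

  odds-row≤ : ∀ l → row (odds (suc l)) ≤ row (evens l)
  odds-row≤ l = proj₂ (rightmost-∈ (evens-∈ l))

  evens-col≤ : ∀ l → col (evens l) ≤ col (odds l)
  evens-col≤ l = proj₂ (lowest-∈ (odds-∈ l))

  -- This is the row reached after `l` descents.
  level : ℕ → ℕ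
  level zero    = row p
  level (suc l) = row (evens l)

  1≤level : ∀ l → 1 ≤ level l
  1≤level zero    = s≤s z≤n
  1≤level (suc l) = s≤s z≤n

  odds-max : ∀ l {w} → ⟦ L ⟧ w → row w ≤ level l → col w ≤ col (odds l)
  odds-max zero    w∈L w≤ = p-rightmost w∈L (≤-antisym (≤-trans w≤ (≤-reflexive top)) (s≤s z≤n))
  odds-max (suc l) w∈L w≤ = maximise-max {P = UpOf (evens l)} _ col (w∈L , w≤)

  evens-max : ∀ l {w} → ⟦ L ⟧ w → col w ≤ col (odds l) → row w ≤ level (suc l)
  evens-max l w∈L w≤ = maximise-max {P = LeftOf (odds l)} _ row (w∈L , w≤)

  col-n⇒level-m : ∀ l → col (odds l) ≡ n → m ≤ level (suc l)
  col-n⇒level-m l eq = ≤-trans (≤-reflexive (sym bottom)) (evens-max l b∈L (≤-trans (col≤n b) (≤-reflexive (sym eq))))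

  -- For the cut at row `level l` and the column of `odds l`, the choice of `odds l` empties the
  -- upper right quadrant, so `L` has a vertex in the lower left one. In the last column there is no
  -- cut, but then `b` itself is a candidate for `evens l`.
  level-< : ∀ l → level l < m → level l < level (suc l)
  level-< l <m with m≤n⇒m<n∨m≡n (col≤n (odds l))
  ... | inj₂ ≡n = <-≤-trans <m (col-n⇒level-m l ≡n)
  ... | inj₁ <n with landmark⇒antidiagonal landmark (1≤level l) <m (s≤s z≤n) <n
  ...   | x , x∈L , inj₁ (r≤ , c>) = contradiction (odds-max l x∈L r≤) (<⇒≱ c>)
  ...   | x , x∈L , inj₂ (r> , c≤) = <-≤-trans r> (evens-max l x∈L c≤)

  -- Now the cut is at row `level (suc l)`: the choice of `evens l` empties the lower left quadrant,
  -- so `L` has a vertex in the upper right one.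
  odds-col-< : ∀ l → level (suc l) < m → col (odds l) < col (odds (suc l))
  odds-col-< l <m with m≤n⇒m<n∨m≡n (col≤n (odds l))
  ... | inj₂ ≡n = contradiction (col-n⇒level-m l ≡n) (<⇒≱ <m)
  ... | inj₁ <n with landmark⇒antidiagonal landmark (1≤level (suc l)) <m (s≤s z≤n) <n
  ...   | x , x∈L , inj₁ (r≤ , c>) = <-≤-trans c> (odds-max (suc l) x∈L r≤)
  ...   | x , x∈L , inj₂ (r> , c≤) = contradiction (evens-max l x∈L c≤) (<⇒≱ r>)

  -- The first descent ends weakly left of `p`, where `L` has no bottom vertex. This is what makes
  -- `k` at least 2.
  level-1< : level 1 < m
  level-1< with m≤n⇒m<n∨m≡n (row≤m (evens 0))
  ... | inj₁ <m = <m
  ... | inj₂ ≡m = contradiction (evens-col≤ 0) (<⇒≱ (bottom-right (evens-∈ 0) ≡m))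

  -- The level rises strictly until it is `m`, so each round pays for one unit of `fuel`; `k` is the
  -- first index with level `m`.
  reach-bottom : ∀ fuel l → m ≤ fuel + level l → (∀ {i} → i ≤ l → level i < m) →
    ∃[ k ] l < k × level k ≡ m × (∀ {i} → i < k → level i < m)
  reach-bottom zero l m≤ below = contradiction m≤ (<⇒≱ (below ≤-refl))
  reach-bottom (suc f) l m≤ below with m≤n⇒m<n∨m≡n (row≤m (evens l))
  ... | inj₂ ≡m = suc l , ≤-refl , ≡m , λ { (s≤s i≤l) → below i≤l }
  ... | inj₁ <m = Product.map₂ (Product.map₁ (<-trans (n<1+n l))) (reach-bottom f (suc l) m≤′ below′)
    where
    m≤′ : m ≤ f + level (suc l)
    m≤′ = ≤-trans m≤ (≤-trans (≤-reflexive (sym (+-suc f (level l)))) (+-monoʳ-≤ f (level-< l (below ≤-refl))))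
    below′ : ∀ {i} → i ≤ suc l → level i < m
    below′ i≤ with m≤n⇒m<n∨m≡n i≤
    ... | inj₁ (s≤s i≤l) = below i≤l
    ... | inj₂ refl      = <m

  -- The path turns where the row of an even entry crosses the column of a neighbouring odd entry.
  oddCorners evenCorners : ℕ → Vertex m n
  oddCorners zero    = p
  oddCorners (suc l) = proj₁ (evens l) , proj₂ (odds (suc l))
  evenCorners l = proj₁ (evens l) , proj₂ (odds l)

  oddCorners-row : ∀ l → row (oddCorners l) ≡ level l
  oddCorners-row zero    = refl
  oddCorners-row (suc l) = refl

  oddCorners-col : ∀ l → col (oddCorners l) ≡ col (odds l)
  oddCorners-col zero    = refl
  oddCorners-col (suc l) = refl

  module _ (k : ℕ) (2≤k : 2 ≤ k) (reached : level k ≡ m) (below : ∀ {i} → i < k → level i < m) where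

    corners entries : Seq k m n
    corners i = interleave oddCorners evenCorners (toℕ i)
    entries i = interleave odds evens (toℕ i)

    half<k : ∀ l {i : Fin (2 * k)} → l * 2 ≤ toℕ i → l < k
    half<k l {i} l*2≤i = *-cancelʳ-< 2 l k (≤-<-trans l*2≤i (subst (toℕ i <_) (*-comm 2 k) (toℕ<n i)))

    last-half : ∀ l {i : Fin (2 * k)} → index i ≡ 2 * k → toℕ i ≡ suc (l * 2) → suc l ≡ k
    last-half l i≡2k i≡ = *-cancelʳ-≡ (suc l) k 2 (trans (sym (cong suc i≡)) (trans i≡2k (*-comm 2 k)))

    last-position : ∀ (i : Fin (2 * k)) → index i ≡ 2 * k → ∃[ l ] toℕ i ≡ suc (l * 2) × suc l ≡ k
    last-position i i≡2k with l , i≡ ← even-position (subst (2 ∣_) (sym i≡2k) (m∣m*n k)) = l , i≡ , last-half l {i} i≡2k i≡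

    corners-zigzag : IsZigzag k corners
    corners-zigzag = record
      { 2≤k       = 2≤k
      ; first     = λ i i≡1 → trans (cong row (interleave-even oddCorners evenCorners 0 (suc-injective i≡1))) top
      ; last      = last
      ; even-step = even-step
      ; odd-step  = odd-step
      }
      where
      last : ∀ i → index i ≡ 2 * k → row (corners i) ≡ m
      last i i≡2k with l , i≡ , refl ← last-position i i≡2k =
        trans (cong row (interleave-odd oddCorners evenCorners l i≡)) reached
      even-step : ∀ i j → index j ≡ suc (index i) → 2 ∣ index j →
        col (corners j) ≡ col (corners i) × row (corners i) < row (corners j)
      even-step i j j≡ 2∣j with l , j≡′ ← even-position 2∣j
        with i≡′ ← suc-injective (trans (sym (suc-injective j≡)) j≡′)
        rewrite interleave-odd oddCorners evenCorners l j≡′ | interleave-even oddCorners evenCorners l i≡′ =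
        sym (oddCorners-col l) ,
        ≤-<-trans (≤-reflexive (oddCorners-row l)) (level-< l (below (half<k l {i} (≤-reflexive (sym i≡′)))))
      odd-step : ∀ i j → index j ≡ suc (index i) → ¬ 2 ∣ index j →
        row (corners j) ≡ row (corners i) × col (corners i) < col (corners j)
      odd-step i j j≡ 2∤j with odd-position 2∤j
      ... | zero  , j≡′ = contradiction (trans (sym (suc-injective j≡)) j≡′) 1+n≢0
      ... | suc l , j≡′ with i≡′ ← suc-injective (trans (sym (suc-injective j≡)) j≡′)
        rewrite interleave-even oddCorners evenCorners (suc l) j≡′ | interleave-odd oddCorners evenCorners l i≡′ =
        refl , odds-col-< l (below (half<k (suc l) {j} (≤-reflexive (sym j≡′))))

    entries-correspond : Corresponds k corners entries
    entries-correspond = record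
      { first      = λ i i≡1 → trans (interleave-even odds evens 0 (suc-injective i≡1))
                                 (sym (interleave-even oddCorners evenCorners 0 (suc-injective i≡1)))
      ; even       = even
      ; odd        = odd
      ; first<last = first<last
      }
      where
      even : ∀ i → 2 ∣ index i → row (entries i) ≡ row (corners i) × col (entries i) ≤ col (corners i)
      even i 2∣i with l , i≡ ← even-position 2∣i
        rewrite interleave-odd odds evens l i≡ | interleave-odd oddCorners evenCorners l i≡ = refl , evens-col≤ l
      odd : ∀ i → ¬ 2 ∣ index i → 3 ≤ index i → col (entries i) ≡ col (corners i) × row (entries i) ≤ row (corners i)
      odd i 2∤i 3≤i with odd-position 2∤i
      ... | zero  , i≡ = contradiction (≤-trans 3≤i (s≤s (≤-reflexive i≡))) λ { (s≤s ()) }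
      ... | suc l , i≡
        rewrite interleave-even odds evens (suc l) i≡ | interleave-even oddCorners evenCorners (suc l) i≡ = refl , odds-row≤ l
      first<last : ∀ i j → index i ≡ 1 → index j ≡ 2 * k → col (entries i) < col (entries j)
      first<last i j i≡1 j≡2k with l , j≡ , refl ← last-position j j≡2k
        rewrite interleave-even odds evens 0 (suc-injective i≡1) | interleave-odd odds evens l j≡ =
        bottom-right (evens-∈ l) reached

  level-≤1 : ∀ {i} → i ≤ 1 → level i < m
  level-≤1 z≤n       = ≤-trans (≤-reflexive (cong suc top)) 2≤m
  level-≤1 (s≤s z≤n) = level-1<

  zigzag : ZigzagIn L
  -- The search starts at level 1 in order to return `1 < k`.
  zigzag with k , 1<k , reached , below ← reach-bottom m 1 (m≤m+n m _) level-≤1 =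
    k , corners k 1<k reached below , entries k 1<k reached below , corners-zigzag k 1<k reached below ,
    entries-correspond k 1<k reached below , λ i → interleave-all ⟦ L ⟧ odds evens odds-∈ evens-∈ (toℕ i)

-- Small landmark sets

-- A list may repeat vertices, so coincidences among the chosen ones require no separate cases.
SmallLandmarkIn : VertexSet m n → Set
SmallLandmarkIn {m} {n} L = Σ[ xs ∈ List (Vertex m n) ] length xs ≤ 3 × (∀ {x} → x ∈ xs → ⟦ L ⟧ x) × IsLandmark (_∈ xs)

private
  three-in : {L : VertexSet m n} {x y z : Vertex m n} → ⟦ L ⟧ x → ⟦ L ⟧ y → ⟦ L ⟧ z →
    ∀ {w} → w ∈ x ∷ y ∷ z ∷ [] → ⟦ L ⟧ w
  three-in x∈ y∈ z∈ (here refl)                 = x∈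
  three-in x∈ y∈ z∈ (there (here refl))         = y∈
  three-in x∈ y∈ z∈ (there (there (here refl))) = z∈

-- The pair `p₁`, `b₁` takes care of the diagonals and `p₂`, `b₂` of the antidiagonals. The pairs
-- may share a vertex, which is how three vertices can suffice.
top-bottom-meetsCuts : {S : Pred (Vertex m n) 0ℓ} {p₁ p₂ b₁ b₂ : Vertex m n} →
  S p₁ → S p₂ → S b₁ → S b₂ → row p₁ ≡ 1 → row p₂ ≡ 1 → row b₁ ≡ m → row b₂ ≡ m →
  col p₁ ≤ col b₁ → col b₂ ≤ col p₂ → (∀ {d} → 1 < d → d < n → ∃[ x ] S x × col x ≢ d) → MeetsCuts S
top-bottom-meetsCuts p₁∈ p₂∈ b₁∈ b₂∈ top₁ top₂ bottom₁ bottom₂ p₁≤b₁ b₂≤p₂ off-col = record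
  { diagonal     = λ 1≤r r<m _ _ → top-bottom-diagonal p₁∈ b₁∈ top₁ bottom₁ p₁≤b₁ 1≤r r<m
  ; antidiagonal = λ 1≤r r<m _ _ → top-bottom-antidiagonal p₂∈ b₂∈ top₂ bottom₂ b₂≤p₂ 1≤r r<m
  ; off-row      = top-off-row p₁∈ top₁
  ; off-col      = off-col
  }

module _ (L : VertexSet m n) (landmark : IsLandmark ⟦ L ⟧) (2≤m : 2 ≤ m) (2≤n : 2 ≤ n) where

  private
    small : ∀ {x y z} → ⟦ L ⟧ x → ⟦ L ⟧ y → ⟦ L ⟧ z → MeetsCuts (_∈ x ∷ y ∷ z ∷ []) → SmallLandmarkIn L
    small x∈ y∈ z∈ cuts = _ , ≤-refl , three-in {L = L} x∈ y∈ z∈ , meetsCuts⇒landmark 2≤m 2≤n cuts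

    1st : {A : Set} {x y z : A} → x ∈ x ∷ y ∷ z ∷ []
    1st = here refl

    2nd : {A : Set} {x y z : A} → y ∈ x ∷ y ∷ z ∷ []
    2nd = there (here refl)

    3rd : {A : Set} {x y z : A} → z ∈ x ∷ y ∷ z ∷ []
    3rd = there (there (here refl))

  module _ {p b : Vertex m n} (p∈L : ⟦ L ⟧ p) (b∈L : ⟦ L ⟧ b) (top : row p ≡ 1) (bottom : row b ≡ m) where

    private
      -- Outside the column of p, unless that column lies on the border.
      third : ∃[ x ] ⟦ L ⟧ x × (1 < col p → col p < n → col x ≢ col p)
      third with 1 <? col p | col p <? n
      ... | yes 1<p | yes p<n with x , x∈L , x≢p ← landmark⇒off-col landmark (≤-trans (s≤s z≤n) 2≤m) 1<p p<n = x , x∈L , λ _ _ → x≢p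
      ... | yes _   | no  p≮n = p , p∈L , λ _ p<n → contradiction p<n p≮n
      ... | no  1≮p | _       = p , p∈L , λ 1<p → contradiction 1<p 1≮p

      x : Vertex m n
      x = proj₁ third

      off-col : ∀ {d} → 1 < d → d < n → ∃[ y ] (y ∈ p ∷ b ∷ x ∷ []) × col y ≢ d
      off-col {d} 1<d d<n with col p ≟ d
      ... | yes refl = x , 3rd , proj₂ (proj₂ third) 1<d d<n
      ... | no  p≢d  = p , 1st , p≢d

      Top : Pred (Vertex m n) 0ℓ
      Top w = ⟦ L ⟧ w × row w ≡ 1

      top? : Decidable Top
      top? w = T? (L w) ×-dec row w ≟ 1

      p′ : Vertex m n
      p′ = maximise top? col p

      p′-top : Top p′
      p′-top = maximise-∈ top? col (p∈L , top)

      BottomLeft : Pred (Vertex m n) 0ℓ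
      BottomLeft w = ⟦ L ⟧ w × row w ≡ m × col w ≤ col p′

      bottomLeft? : Decidable BottomLeft
      bottomLeft? w = T? (L w) ×-dec row w ≟ m ×-dec col w ≤? col p′

    -- In a common column, `p` and `b` meet the diagonal and the antidiagonal pair of every cut; the
    -- third vertex lies off that column if it is interior.
    aligned⇒small : col p ≡ col b → SmallLandmarkIn L
    aligned⇒small p≡b =
      small p∈L b∈L (proj₁ (proj₂ third)) (top-bottom-meetsCuts 1st 1st 2nd 2nd top top bottom bottom
        (≤-reflexive p≡b) (≤-reflexive (sym p≡b)) off-col)

    -- If `b` is weakly left of the rightmost top vertex `p′`, then `p`, `p′`, `b` suffice; if
    -- another bottom vertex `w` is, then `p′`, `b`, `w` do. Otherwise `p′` starts a staircase.
    ascending⇒small⊎zigzag : col p < col b → SmallLandmarkIn L ⊎ ZigzagIn L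
    ascending⇒small⊎zigzag p<b with p′∈L , top′ ← p′-top | col b ≤? col p′
    ... | yes b≤p′ = inj₁ (small p∈L p′∈L b∈L (top-bottom-meetsCuts 1st 2nd 3rd 3rd top top′ bottom bottom
          (<⇒≤ p<b) b≤p′ (two-columns-off-col 1st 3rd (<⇒≢ p<b))))
    ... | no  b≰p′ with any? bottomLeft? (allVertices m n)
    ...   | yes found with w , _ , w∈L , bottom-w , w≤p′ ← find found =
            inj₁ (small p′∈L b∈L w∈L (top-bottom-meetsCuts 1st 1st 2nd 3rd top′ top′ bottom bottom-w
              (<⇒≤ (≰⇒> b≰p′)) w≤p′ (two-columns-off-col 1st 2nd (<⇒≢ (≰⇒> b≰p′)))))
    ...   | no  none = inj₂ (Staircase.zigzag L landmark 2≤m p′∈L b∈L top′ bottom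
            (λ w∈L top-w → maximise-max top? col (w∈L , top-w))
            (λ w∈L bottom-w → ≰⇒> λ w≤p′ → none (lose (∈-allVertices _) (w∈L , bottom-w , w≤p′))))

-- Renumberings

private
  variable
    m′ n′ : ℕ

inverse : Renumbering m n m′ n′ → Renumbering m′ n′ m n
inverse (direct     r s) = direct r s
inverse (transposed r s) = transposed s r

flipIf-involutive : ∀ r (i : Fin n) → flipIf r (flipIf r i) ≡ i
flipIf-involutive true  i = opposite-involutive i
flipIf-involutive false i = refl

original-inverse : (ρ : Renumbering m n m′ n′) (v : Vertex m n) → original ρ (original (inverse ρ) v) ≡ v
original-inverse (direct     r s) (i , j) = cong₂ _,_ (flipIf-involutive r i) (flipIf-involutive s j)
original-inverse (transposed r s) (i , j) = cong₂ _,_ (flipIf-involutive r i) (flipIf-involutive s j)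

inverse-original : (ρ : Renumbering m n m′ n′) (v : Vertex m′ n′) → original (inverse ρ) (original ρ v) ≡ v
inverse-original (direct     r s) = original-inverse (direct r s)
inverse-original (transposed r s) = original-inverse (transposed s r)

original-injective : (ρ : Renumbering m n m′ n′) {u v : Vertex m′ n′} → original ρ u ≡ original ρ v → u ≡ v
original-injective ρ eq = trans (sym (inverse-original ρ _)) (trans (cong (original (inverse ρ)) eq) (inverse-original ρ _))

opposite-sum : (i : Fin n) → toℕ (opposite i) + suc (toℕ i) ≡ n
opposite-sum i = trans (cong (_+ suc (toℕ i)) (opposite-prop i)) (m∸n+n≡m (toℕ<n i))

opposite-antitone : {i j : Fin n} → toℕ j < toℕ i → toℕ (opposite i) < toℕ (opposite j)
opposite-antitone {i = i} {j} j<i = subst₂ _<_ (sym (opposite-prop i)) (sym (opposite-prop j)) (∸-monoʳ-< (s≤s j<i) (toℕ<n i))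

-- An index and its opposite have a constant sum, so shifting by a common amount turns the
-- difference of the opposites into the reversed difference of the indices.
flipIf-distance : ∀ r (i j : Fin n) → ∣ toℕ (flipIf r i) - toℕ (flipIf r j) ∣ ≡ ∣ toℕ i - toℕ j ∣
flipIf-distance false i j = refl
flipIf-distance true  i j = begin
  ∣ x - y ∣          ≡⟨ ∣m+n-m+o∣≡∣n-o∣ a x y ⟨
  ∣ a + x - a + y ∣  ≡⟨ cong₂ ∣_-_∣ (trans (+-comm a x) (trans (opposite-sum i) (sym (opposite-sum j)))) (+-comm a y) ⟩
  ∣ y + b - y + a ∣  ≡⟨ ∣m+n-m+o∣≡∣n-o∣ y b a ⟩
  ∣ b - a ∣          ≡⟨ ∣-∣-comm b a ⟩
  ∣ a - b ∣          ∎
  where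
  open ≡-Reasoning
  x y a b : ℕ
  x = toℕ (opposite i)
  y = toℕ (opposite j)
  a = suc (toℕ i)
  b = suc (toℕ j)

original-dist : (ρ : Renumbering m n m′ n′) (u v : Vertex m′ n′) → dist (original ρ u) (original ρ v) ≡ dist u v
original-dist (direct     r s) (i , j) (i₂ , j₂) = cong₂ _+_ (flipIf-distance r i i₂) (flipIf-distance s j j₂)
original-dist (transposed r s) (i , j) (i₂ , j₂) =
  trans (cong₂ _+_ (flipIf-distance r j j₂) (flipIf-distance s i i₂)) (+-comm ∣ toℕ j - toℕ j₂ ∣ _)

-- Renumbering is an isometric bijection: the pair is pulled back, separated there, and the
-- separating vertex carried forward.
landmark-original : (ρ : Renumbering m n m′ n′) {S : Pred (Vertex m n) 0ℓ} {S′ : Pred (Vertex m′ n′) 0ℓ} →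
  (∀ {x} → S′ x → S (original ρ x)) → IsLandmark S′ → IsLandmark S
landmark-original ρ S′⊆S landmark u v u≢v
  with x , x∈S′ , sep ← landmark (original (inverse ρ) u) (original (inverse ρ) v) (u≢v ∘ original-injective (inverse ρ)) =
  original ρ x , S′⊆S x∈S′ , λ eq → sep (trans (distance x u) (trans eq (sym (distance x v))))
  where
  distance : ∀ x w → dist x (original (inverse ρ) w) ≡ dist (original ρ x) w
  distance x w = trans (sym (original-dist ρ x _)) (cong (dist (original ρ x)) (original-inverse ρ w))

landmark-renumbered : (ρ : Renumbering m n m′ n′) (L : VertexSet m n) → IsLandmark ⟦ L ⟧ → IsLandmark ⟦ L ∘ original ρ ⟧
landmark-renumbered ρ L = landmark-original (inverse ρ) (subst ⟦ L ⟧ (sym (original-inverse ρ _)))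

small-original : (ρ : Renumbering m n m′ n′) (L : VertexSet m n) → SmallLandmarkIn (L ∘ original ρ) → SmallLandmarkIn L
small-original ρ L (xs , ≤3 , xs⊆L , landmark) =
  map (original ρ) xs , subst (_≤ 3) (sym (length-map (original ρ) xs)) ≤3 ,
  (λ y∈ → mapped (∈-map⁻ (original ρ) y∈)) , landmark-original ρ (∈-map⁺ (original ρ)) landmark
  where
  mapped : ∀ {y} → ∃[ x ] x ∈ xs × y ≡ original ρ x → ⟦ L ⟧ y
  mapped (x , x∈ , refl) = xs⊆L x∈

RenumberedZigzagIn : VertexSet m n → Set
RenumberedZigzagIn {m} {n} L = Σ[ m′ ∈ ℕ ] Σ[ n′ ∈ ℕ ] Σ[ ρ ∈ Renumbering m n m′ n′ ] ZigzagIn (L ∘ original ρ)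

-- Reduction to the top and bottom rows

module _ (L : VertexSet m n) (landmark : IsLandmark ⟦ L ⟧) (2≤m : 2 ≤ m) (2≤n : 2 ≤ n) where

  -- A reflection of the columns turns the case of `b` left of `p` into the ascending one.
  top-bottom⇒small⊎zigzag : {p b : Vertex m n} → ⟦ L ⟧ p → ⟦ L ⟧ b → row p ≡ 1 → row b ≡ m →
    SmallLandmarkIn L ⊎ (Σ[ s ∈ Bool ] ZigzagIn (L ∘ original (direct false s)))
  top-bottom⇒small⊎zigzag {p} {b} p∈L b∈L top bottom with <-cmp (col p) (col b)
  ... | tri≈ _ p≡b _ = inj₁ (aligned⇒small L landmark 2≤m 2≤n p∈L b∈L top bottom p≡b)
  ... | tri< p<b _ _ = Sum.map₂ (false ,_) (ascending⇒small⊎zigzag L landmark 2≤m 2≤n p∈L b∈L top bottom p<b)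
  ... | tri> _ _ b<p = Sum.map (small-original ρ L) (true ,_)
          (ascending⇒small⊎zigzag (L ∘ original ρ) (landmark-renumbered ρ L landmark) 2≤m 2≤n
            (flipped p∈L) (flipped b∈L) top bottom
            (s≤s (opposite-antitone (≤-pred b<p))))
    where
    ρ : Renumbering m n m n
    ρ = direct false true
    flipped : ∀ {v} → ⟦ L ⟧ v → ⟦ L ∘ original ρ ⟧ (original ρ v)
    flipped = subst ⟦ L ⟧ (sym (original-inverse ρ _))

  private
    1≤pred : ∀ {l} → 2 ≤ l → 1 ≤ l ∸ 1
    1≤pred (s≤s 1≤l) = 1≤l

    pred< : ∀ {l} → 2 ≤ l → l ∸ 1 < l
    pred< (s≤s _) = ≤-refl

    ≡first : ∀ {x} → suc x ≤ 1 → suc x ≡ 1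
    ≡first (s≤s z≤n) = refl

    ≡last : ∀ {x l} → l ∸ 1 < x → x ≤ l → x ≡ l
    ≡last {l = zero}  (s≤s _) ()
    ≡last {l = suc l} l<x     x≤l = ≤-antisym x≤l l<x

    -- The cut next to this corner has its antidiagonal quadrants inside the first row and the first
    -- column. The other corners are treated alike.
    top-left : ∃[ x ] ⟦ L ⟧ x × (row x ≡ 1 ⊎ col x ≡ 1)
    top-left with landmark⇒antidiagonal landmark ≤-refl 2≤m ≤-refl 2≤n
    ... | x , x∈L , inj₁ (r , _) = x , x∈L , inj₁ (≡first r)
    ... | x , x∈L , inj₂ (_ , c) = x , x∈L , inj₂ (≡first c)

    bottom-right : ∃[ x ] ⟦ L ⟧ x × (row x ≡ m ⊎ col x ≡ n)
    bottom-right with landmark⇒antidiagonal landmark (1≤pred 2≤m) (pred< 2≤m) (1≤pred 2≤n) (pred< 2≤n)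
    ... | x , x∈L , inj₁ (_ , c) = x , x∈L , inj₂ (≡last c (col≤n x))
    ... | x , x∈L , inj₂ (r , _) = x , x∈L , inj₁ (≡last r (row≤m x))

    top-right : ∃[ x ] ⟦ L ⟧ x × (row x ≡ 1 ⊎ col x ≡ n)
    top-right with landmark⇒diagonal landmark ≤-refl 2≤m (1≤pred 2≤n) (pred< 2≤n)
    ... | x , x∈L , inj₁ (r , _) = x , x∈L , inj₁ (≡first r)
    ... | x , x∈L , inj₂ (_ , c) = x , x∈L , inj₂ (≡last c (col≤n x))

    bottom-left : ∃[ x ] ⟦ L ⟧ x × (row x ≡ m ⊎ col x ≡ 1)
    bottom-left with landmark⇒diagonal landmark (1≤pred 2≤m) (pred< 2≤m) ≤-refl 2≤n
    ... | x , x∈L , inj₁ (_ , c) = x , x∈L , inj₂ (≡first c)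
    ... | x , x∈L , inj₂ (r , _) = x , x∈L , inj₁ (≡last r (row≤m x))

  -- If the top left and bottom right corners yield adjacent sides, say top and right, then the
  -- corner between the other two sides completes an opposite pair either way.
  opposite-sides :
    (∃[ p ] ∃[ b ] ⟦ L ⟧ p × ⟦ L ⟧ b × row p ≡ 1 × row b ≡ m) ⊎
    (∃[ p ] ∃[ b ] ⟦ L ⟧ p × ⟦ L ⟧ b × col p ≡ 1 × col b ≡ n)
  opposite-sides with top-left | bottom-right | top-right | bottom-left
  ... | p , p∈ , inj₁ top  | b , b∈ , inj₁ bottom | _                      | _                       = inj₁ (p , b , p∈ , b∈ , top , bottom)
  ... | p , p∈ , inj₁ top  | _ , _  , inj₂ _      | _                      | b , b∈ , inj₁ bottom    = inj₁ (p , b , p∈ , b∈ , top , bottom)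
  ... | _ , _  , inj₁ _    | b , b∈ , inj₂ right  | _                      | p , p∈ , inj₂ left      = inj₂ (p , b , p∈ , b∈ , left , right)
  ... | p , p∈ , inj₂ left | b , b∈ , inj₂ right  | _                      | _                       = inj₂ (p , b , p∈ , b∈ , left , right)
  ... | p , p∈ , inj₂ left | _ , _  , inj₁ _      | b , b∈ , inj₂ right    | _                       = inj₂ (p , b , p∈ , b∈ , left , right)
  ... | _ , _  , inj₂ _    | b , b∈ , inj₁ bottom | p , p∈ , inj₁ top      | _                       = inj₁ (p , b , p∈ , b∈ , top , bottom)

landmark⇒small⊎zigzag : (L : VertexSet m n) → IsLandmark ⟦ L ⟧ → 2 ≤ m → 2 ≤ n → SmallLandmarkIn L ⊎ RenumberedZigzagIn L
landmark⇒small⊎zigzag {m} {n} L landmark 2≤m 2≤n with opposite-sides L landmark 2≤m 2≤n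
... | inj₁ (p , b , p∈L , b∈L , top , bottom) = Sum.map₂ (λ (s , z) → m , n , direct false s , z)
  (top-bottom⇒small⊎zigzag L landmark 2≤m 2≤n p∈L b∈L top bottom)
-- Transposing first and then reflecting the new columns amounts, by computation, to
-- `transposed s false`.
... | inj₂ (p , b , p∈L , b∈L , left , right) = Sum.map (small-original ρ L) (λ (s , z) → n , m , transposed s false , z)
  (top-bottom⇒small⊎zigzag (L ∘ original ρ) (landmark-renumbered ρ L landmark) 2≤n 2≤m
    {original (inverse ρ) p} {original (inverse ρ) b} p∈L b∈L left right)
  where
  ρ : Renumbering m n n m
  ρ = transposed false false

-- Minimality and cost

∈-remove : {A : Set} {x y : A} (as : List A) {bs : List A} → x ≢ y → y ∈ as ++ x ∷ bs → y ∈ as ++ bs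
∈-remove as x≢y y∈ with ∈-++⁻ as y∈
... | inj₁ y∈as         = ∈-++⁺ˡ y∈as
... | inj₂ (here refl)  = contradiction refl x≢y
... | inj₂ (there y∈bs) = ∈-++⁺ʳ as y∈bs

-- Each element of `xs` is cut out of `ys`; the later ones survive because they differ from it. The
-- remainder `zs` lets both lengths and costs be compared.
unique⊆⇒↭++ : {A : Set} {xs ys : List A} → Unique xs → (∀ {x} → x ∈ xs → x ∈ ys) → ∃[ zs ] ys ↭ xs ++ zs
unique⊆⇒↭++ {ys = ys} [] _ = ys , ↭-refl
unique⊆⇒↭++ {xs = x ∷ xs} (x∉xs ∷ unique) xs⊆ys with as , bs , refl ← ∈-∃++ (xs⊆ys (here refl))
  with zs , perm ← unique⊆⇒↭++ {ys = as ++ bs} unique (λ y∈xs → ∈-remove as (All.lookup x∉xs y∈xs) (xs⊆ys (there y∈xs))) =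
  zs , ↭-trans (shift x as bs) (↭-prep x perm)

unique⊆⇒length≤ : {A : Set} {xs ys : List A} → Unique xs → (∀ {x} → x ∈ xs → x ∈ ys) → length xs ≤ length ys
unique⊆⇒length≤ {xs = xs} unique xs⊆ys with zs , perm ← unique⊆⇒↭++ unique xs⊆ys =
  ≤-trans (m≤m+n (length xs) (length zs)) (≤-reflexive (sym (trans (↭-length perm) (length-++ xs))))

module _ {c : Cost m n} (0≤c : ∀ v → 0ℚ ℚ.≤ c v) where

  total-nonNeg : ∀ vs → 0ℚ ℚ.≤ total c vs
  total-nonNeg []       = ℚₚ.≤-refl
  total-nonNeg (v ∷ vs) = ℚₚ.+-mono-≤ (0≤c v) (total-nonNeg vs)

  total-++ : ∀ vs ws → total c vs ℚ.≤ total c (vs ++ ws)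
  total-++ []       ws = total-nonNeg ws
  total-++ (v ∷ vs) ws = ℚₚ.+-monoʳ-≤ (c v) (total-++ vs ws)

  unique⊆⇒total≤ : ∀ {vs ws} → Unique vs → (∀ {v} → v ∈ vs → v ∈ ws) → total c vs ℚ.≤ total c ws
  unique⊆⇒total≤ {vs} unique vs⊆ws with zs , perm ← unique⊆⇒↭++ unique vs⊆ws =
    ℚₚ.≤-trans (total-++ vs zs) (ℚₚ.≤-reflexive (sym (total-↭ perm)))
    where
    total-↭ : ∀ {vs ws} → vs ↭ ws → total c vs ≡ total c ws
    total-↭ perm = foldr-commMonoid (setoid _) ℚₚ.+-0-isCommutativeMonoid (↭⇒↭ₛ (map⁺ c perm))

elements-unique : (L : VertexSet m n) → Unique (elements L)
elements-unique {m} {n} L = Uniqueₚ.filter⁺ (T? ∘ L) (Uniqueₚ.cartesianProduct⁺ (Uniqueₚ.allFin⁺ m) (Uniqueₚ.allFin⁺ n))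

∈-elements⁺ : (L : VertexSet m n) → ∀ {v} → ⟦ L ⟧ v → v ∈ elements L
∈-elements⁺ L = ∈-filter⁺ (T? ∘ L) (∈-allVertices _)

∈-elements⁻ : (L : VertexSet m n) → ∀ {v} → v ∈ elements L → ⟦ L ⟧ v
∈-elements⁻ {m} {n} L = proj₂ ∘ ∈-filter⁻ (T? ∘ L) {xs = allVertices m n}

fromList : List (Vertex m n) → VertexSet m n
fromList xs v = isYes (v ∈? xs)

∈-fromList⁺ : ∀ {xs} {v : Vertex m n} → v ∈ xs → ⟦ fromList xs ⟧ v
∈-fromList⁺ = fromWitness

∈-fromList⁻ : ∀ {xs} {v : Vertex m n} → ⟦ fromList xs ⟧ v → v ∈ xs
∈-fromList⁻ = toWitness

landmark-⊆ : {S S′ : Pred (Vertex m n) 0ℓ} → (∀ {x} → S x → S′ x) → IsLandmark S → IsLandmark S′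
landmark-⊆ S⊆S′ landmark u v u≢v with x , x∈S , sep ← landmark u v u≢v = x , S⊆S′ x∈S , sep

-- If `v` were missing, the list would be a landmark set properly inside `L`. Membership in a list
-- is decidable, so the refutation suffices.
minimal⇒⊆ : (L : VertexSet m n) → IsMinimalLandmark L → ∀ {xs} → (∀ {x} → x ∈ xs → ⟦ L ⟧ x) → IsLandmark (_∈ xs) →
  ∀ {v} → ⟦ L ⟧ v → v ∈ xs
minimal⇒⊆ L (_ , minimal) {xs} xs⊆L landmark {v} v∈L = decidable-stable (v ∈? xs) λ v∉xs →
  minimal (fromList xs) ((λ x∈ → xs⊆L (∈-fromList⁻ x∈)) , λ L⊆xs → v∉xs (∈-fromList⁻ (L⊆xs v∈L)))
    (landmark-⊆ ∈-fromList⁺ landmark)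

module _ {c : Cost m n} (0≤c : ∀ v → 0ℚ ℚ.≤ c v)
  {L : VertexSet m n} (minimal : IsMinimalLandmark L) (minimum : IsMinimumCostLandmark c L) where

  minimal⇒no-small : 4 ≤ card L → ¬ SmallLandmarkIn L
  minimal⇒no-small 4≤L (xs , xs≤3 , xs⊆L , landmark) = contradiction
    (≤-trans 4≤L (≤-trans (unique⊆⇒length≤ (elements-unique L) (minimal⇒⊆ L minimal xs⊆L landmark ∘ ∈-elements⁻ L)) xs≤3)) 1+n≰n

  module _ (ρ : Renumbering m n m′ n′) (2≤m′ : 2 ≤ m′) (2≤n′ : 2 ≤ n′) {k : ℕ} {q t : Seq k m′ n′}
    (isZigzag : IsZigzag k q) (corresponds : Corresponds k q t) (t∈L : ∀ i → ⟦ L ∘ original ρ ⟧ (t i)) where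

    private
      -- Entries are carried back to the original grid, to which the hypotheses on `L` and `c`
      -- refer.
      list : Seq k m′ n′ → List (Vertex m n)
      list s = tabulate (original ρ ∘ s)

      list-landmark : ∀ {s} → Corresponds k q s → IsLandmark (_∈ list s)
      list-landmark {s} corr = landmark-original ρ (λ { (i , refl) → ∈-tabulate⁺ i })
        (meetsCuts⇒landmark 2≤m′ 2≤n′ (corresponding-meetsCuts isZigzag corr))

      total-list : ∀ s → total (c ∘ original ρ) (tabulate s) ≡ total c (list s)
      total-list s = cong (foldr ℚ._+_ 0ℚ) (trans (map-tabulate s (c ∘ original ρ)) (sym (map-tabulate (original ρ ∘ s) c)))

      list⊆L : ∀ {v} → v ∈ list t → ⟦ L ⟧ v
      list⊆L v∈ with i , refl ← ∈-tabulate⁻ v∈ = t∈L i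

      list-unique : Unique (list t)
      list-unique = Uniqueₚ.tabulate⁺ (corresponding-injective isZigzag corresponds ∘ original-injective ρ)

    renumbered≐image : ⟦ L ∘ original ρ ⟧ ≐ image t
    renumbered≐image = ⊆image , λ { (i , refl) → t∈L i }
      where
      ⊆image : ∀ {v} → ⟦ L ∘ original ρ ⟧ v → image t v
      ⊆image v∈ with i , eq ← ∈-tabulate⁻ (minimal⇒⊆ L minimal list⊆L (list-landmark corresponds) v∈) =
        i , sym (original-injective ρ eq)

    -- Any competitor `s` for the same zigzag sequence also gives a landmark set, which costs at
    -- least as much as `L`; and `L` costs at least as much as the distinct entries of `t` inside
    -- it, costs being nonnegative.
    zigzag-perfect : IsPerfect k (c ∘ original ρ) q t
    zigzag-perfect = corresponds , λ s corr → begin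
      total (c ∘ original ρ) (tabulate t)   ≡⟨ total-list t ⟩
      total c (list t)                      ≤⟨ unique⊆⇒total≤ 0≤c list-unique (∈-elements⁺ L ∘ list⊆L) ⟩
      cost c L                              ≤⟨ proj₂ minimum (fromList (list s)) (landmark-⊆ ∈-fromList⁺ (list-landmark corr)) ⟩
      cost c (fromList (list s))            ≤⟨ unique⊆⇒total≤ 0≤c (elements-unique _) (∈-fromList⁻ ∘ ∈-elements⁻ _) ⟩
      total c (list s)                      ≡⟨ total-list s ⟨
      total (c ∘ original ρ) (tabulate s)   ∎
      where open ℚₚ.≤-Reasoning

renumbering-2≤ : Renumbering m n m′ n′ → 2 ≤ m → 2 ≤ n → 2 ≤ m′ × 2 ≤ n′
renumbering-2≤ (direct     _ _) 2≤m 2≤n = 2≤m , 2≤n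
renumbering-2≤ (transposed _ _) 2≤m 2≤n = 2≤n , 2≤m

mainTheorem1 : (m n : ℕ) → 2 ≤ m → 2 ≤ n →
    (c : Cost m n) → (∀ v → 0ℚ ℚ.≤ c v) →
    ((k : ℕ) (q t : Seq k m n) → IsZigzag k q → Corresponds k q t → IsLandmark (image t))
    ×
    ((L : VertexSet m n) → 4 ≤ card L → IsMinimalLandmark L → IsMinimumCostLandmark c L →
    Σ[ m′ ∈ ℕ ] Σ[ n′ ∈ ℕ ] Σ[ ρ ∈ Renumbering m n m′ n′ ]
    Σ[ k ∈ ℕ ] Σ[ q ∈ Seq k m′ n′ ] Σ[ t ∈ Seq k m′ n′ ]
    IsZigzag k q
    × IsPerfect k (c ∘ original ρ) q t
    × Injective _≡_ _≡_ t
    × ⟦ L ∘ original ρ ⟧ ≐ image t)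
mainTheorem1 m n 2≤m 2≤n c 0≤c =
  (λ k q t isZigzag corr → meetsCuts⇒landmark 2≤m 2≤n (corresponding-meetsCuts isZigzag corr)) , structure
  where
  structure : (L : VertexSet m n) → 4 ≤ card L → IsMinimalLandmark L → IsMinimumCostLandmark c L →
    Σ[ m′ ∈ ℕ ] Σ[ n′ ∈ ℕ ] Σ[ ρ ∈ Renumbering m n m′ n′ ]
    Σ[ k ∈ ℕ ] Σ[ q ∈ Seq k m′ n′ ] Σ[ t ∈ Seq k m′ n′ ]
    IsZigzag k q × IsPerfect k (c ∘ original ρ) q t × Injective _≡_ _≡_ t × ⟦ L ∘ original ρ ⟧ ≐ image t
  structure L 4≤L minimal minimum with landmark⇒small⊎zigzag L (proj₁ minimal) 2≤m 2≤n
  ... | inj₁ small = contradiction small (minimal⇒no-small 0≤c minimal minimum 4≤L)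
  ... | inj₂ (m′ , n′ , ρ , k , q , t , isZigzag , corr , t∈L) with 2≤m′ , 2≤n′ ← renumbering-2≤ ρ 2≤m 2≤n =
    m′ , n′ , ρ , k , q , t , isZigzag ,
    zigzag-perfect 0≤c minimal minimum ρ 2≤m′ 2≤n′ isZigzag corr t∈L ,
    corresponding-injective isZigzag corr ,
    renumbered≐image 0≤c minimal minimum ρ 2≤m′ 2≤n′ isZigzag corr t∈L
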